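{- For every positive integer $n$, \[ \mathrm{ex}(Q_n, C_{10}) > \frac{c}{12}\cdot e(Q_n), \qquad \text{where } c=\prod_{k=1}^\infty\left(1-\frac{1}{2^k}\right). \]
   Context: The $n$-dimensional hypercube $Q_n$ is the graph with vertex set $\{0,1\}^n$ in which two vertices are adjacent if and only if they differ in exactly one coordinate; $e(Q_n)$ denotes its number of edges. For a graph $H$, $\mathrm{ex}(Q_n,H)$ is the maximum number of edges of a subgraph of $Q_n$ containing no copy of $H$. $C_{10}$ is the cycle of length $10$. -}

module Defs where

open import Data.Nat using (ℕ; zero; suc; _+_; _*_; _∸_; _^_; _≤_; _<_)
open import Data.Bool using (Bool; true; false; not; if_then_else_)
open import Data.Fin using (Fin)
open import Data.Vec using (Vec; []; _∷_; lookup; _[_]≔_)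
open import Data.List using (List; []; _∷_; map; _++_; concatMap; allFin)
open import Data.Nat.ListAction using (sum)
open import Data.Product using (Σ; _×_; _,_; ∃-syntax)
open import Relation.Binary.PropositionalEquality using (_≡_)
open import Function.Definitions using (Injective)

Vertex : ℕ → Set
Vertex n = Vec Bool n

allVertices : (n : ℕ) → List (Vertex n)
allVertices zero = [] ∷ []
allVertices (suc n) = map (false ∷_) (allVertices n) ++ map (true ∷_) (allVertices n)

flip : ∀ {n} → Vertex n → Fin n → Vertex n
flip v i = v [ i ]≔ not (lookup v i)

-- A spanning subgraph of Q_n.  The edge {v, flip v i} of Q_n is identified
-- with the pair (v [ i ]≔ false , i)  (its endpoint with 0 in coordinate i);
-- the subgraph S contains that edge iff  S (v [ i ]≔ false) i ≡ true.
-- (Values of S at pairs (u , i) with lookup u i ≡ true are irrelevant.)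
Subgraph : ℕ → Set
Subgraph n = Vertex n → Fin n → Bool

fullQ : (n : ℕ) → Subgraph n
fullQ n _ _ = true

Adj : ∀ {n} → Subgraph n → Vertex n → Vertex n → Set
Adj {n} S u w = ∃[ i ] (w ≡ flip u i × S (u [ i ]≔ false) i ≡ true)

edgeCount : ∀ {n} → Subgraph n → ℕ
edgeCount {n} S =
  sum (concatMap (λ v → map (λ i → if lookup v i then 0 else (if S v i then 1 else 0))
                             (allFin n))
                 (allVertices n))

eQ : ℕ → ℕ
eQ n = edgeCount (fullQ n)

next10 : Fin 10 → Fin 10
next10 i = Data.Fin.fromℕ< {m = (suc (Data.Fin.toℕ i)) Data.Nat.% 10} (Data.Nat.DivMod.m%n<n (suc (Data.Fin.toℕ i)) 10)
  where import Data.Nat.DivMod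

ContainsC10 : ∀ {n} → Subgraph n → Set
ContainsC10 {n} S =
  Σ (Fin 10 → Vertex n) λ c → Injective _≡_ _≡_ c × (∀ j → Adj S (c j) (c (next10 j)))

-- Partial products for c = ∏_{k≥1} (1 - 1/2^k):
--   P_K = ∏_{k=1}^K (2^k - 1) / ∏_{k=1}^K 2^k = numP K / denP K.
numP : ℕ → ℕ
numP zero = 1
numP (suc K) = numP K * (2 ^ suc K ∸ 1)

denP : ℕ → ℕ
denP zero = 1
denP (suc K) = denP K * 2 ^ suc K

{-# OPTIONS --safe #-}

-- Attach random vectors of F₂^n to the coordinates and fix a random vector w. An edge from A up to
-- B = A ∪ {i}, with |B| = k, is kept when the parity of |A| and the parity of the number of elements
-- of A to the left of i are prescribed, the vectors of B, truncated to k bits, form a basis of F₂^k,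
-- and i lies in the unique D ⊆ B whose vectors sum to w. On average at least a ∏_{l≤n} (1 - 2⁻ˡ) / 8
-- fraction of the edges is kept.
--
-- By the parity of |A|, a 10-cycle of kept edges alternates between two layers, passing through upper
-- sets B₀, …, B₄ with B_{j+1} = B_j - x_j + y_j; here x₀, …, x₄ are distinct and are a permutation of
-- the y_j, so the cycle is a chord diagram on 10 points. The sign (-1)^(elements to the left) is that
-- of anticommuting generators, so the number of crossing chords is even. In each remaining diagram
-- two of the sets D_j have a symmetric difference that is nonempty and contained in some B_l, which
-- contradicts the independence of B_l.
module Submission where

open import Defs
open import Algebra.Bundles using (module CommutativeRing)
open import Data.Bool using (Bool; true; false; not; _∧_; _∨_; _xor_; if_then_else_)
open import Data.Bool.ListAction using (any)
open import Data.Bool.Properties as Bool using (xor-assoc; xor-same; xor-identityʳ; not-involutive; not-distribˡ-xor; not-distribʳ-xor)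
open import Data.Empty using (⊥; ⊥-elim)
open import Data.Fin using (Fin; zero; suc; _≟_)
open import Data.Fin.Patterns
open import Data.List using (List; []; _∷_; map; _++_; length; cartesianProductWith; concatMap; allFin)
open import Data.List.Membership.Propositional using (_∈_)
open import Data.List.Membership.Propositional.Properties using (∈-map⁺; ∈-map⁻; ∈-++⁺ˡ; ∈-++⁺ʳ; ∈-++⁻)
open import Data.List.Properties using (length-map; length-++; map-++; map-∘)
open import Data.List.Relation.Unary.All as All using (All; []; _∷_)
open import Data.List.Relation.Unary.AllPairs using (AllPairs; []; _∷_)
open import Data.List.Relation.Unary.Any using (here; there)
open import Data.List.Relation.Unary.Unique.Propositional using (Unique)
import Data.List.Relation.Unary.Unique.Propositional.Properties as Unique
open import Data.Maybe using (Maybe; just; nothing)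
open import Data.Nat using (ℕ; zero; suc; _+_; _*_; _∸_; _^_; _≤_; _<_; z≤n; s≤s; _≤?_; NonZero; >-nonZero)
open import Data.Nat.ListAction using (sum)
open import Data.Nat.ListAction.Properties using (sum-++)
open import Data.Nat.Properties hiding (_≟_)
open import Data.Nat.Solver using (module +-*-Solver)
open import Data.Product using (Σ; _×_; _,_; ∃-syntax; proj₁; proj₂)
open import Data.Sum using (_⊎_; inj₁; inj₂)
open import Data.Vec using (Vec; []; _∷_; lookup; _[_]≔_; zipWith; replicate)
open import Data.Vec.Properties using (≡-dec; ∷-injectiveʳ; lookup-zipWith; zipWith-comm; zipWith-assoc; zipWith-identityˡ; []≔-idempotent; []≔-lookup; lookup∘updateAt; lookup∘updateAt′)
open import Function using (_∘_)
open import Relation.Binary.PropositionalEquality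
open import Relation.Nullary using (¬_; Dec; yes; no; does; contradiction)
open import Relation.Nullary.Decidable using (dec-true)

open +-*-Solver using (solve; _:=_; _:*_; _:+_; con)

true≢false : ∀ {b} → b ≡ true → b ≡ false → ⊥
true≢false refl ()

-- Coordinate flips and the sign of a word of flips

lookup-flip : ∀ {n} (v : Vertex n) i → lookup (flip v i) i ≡ not (lookup v i)
lookup-flip v i = lookup∘updateAt i v

lookup-flip′ : ∀ {n} (v : Vertex n) {i j} → j ≢ i → lookup (flip v i) j ≡ lookup v j
lookup-flip′ v {i} {j} j≢i = lookup∘updateAt′ j i j≢i v

flip-flip : ∀ {n} (v : Vertex n) i → flip (flip v i) i ≡ v
flip-flip (a ∷ v) zero    = cong (_∷ v) (not-involutive a)
flip-flip (a ∷ v) (suc i) = cong (a ∷_) (flip-flip v i)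

flip-comm : ∀ {n} (v : Vertex n) i j → flip (flip v i) j ≡ flip (flip v j) i
flip-comm (a ∷ v) zero    zero    = refl
flip-comm (a ∷ v) zero    (suc j) = refl
flip-comm (a ∷ v) (suc i) zero    = refl
flip-comm (a ∷ v) (suc i) (suc j) = cong (a ∷_) (flip-comm v i j)

leftParity : ∀ {n} → Vertex n → Fin n → Bool
leftParity (a ∷ v) zero    = false
leftParity (a ∷ v) (suc i) = a xor leftParity v i

leftParity-update : ∀ {n} (v : Vertex n) i b → leftParity (v [ i ]≔ b) i ≡ leftParity v i
leftParity-update (a ∷ v) zero    b = refl
leftParity-update (a ∷ v) (suc i) b = cong (a xor_) (leftParity-update v i b)

-- Of two distinct coordinates exactly one lies to the left of the other. Flipping the left one
-- changes the left parity of the right one, and not conversely, so exchanging two flips changes the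
-- total sign: this is the Jordan-Wigner relation for anticommuting generators.
leftParity-anticomm : ∀ {n} (v : Vertex n) {i j} → i ≢ j →
  leftParity v i xor leftParity (flip v i) j ≡ not (leftParity v j xor leftParity (flip v j) i)
leftParity-anticomm (a ∷ v) {zero}  {zero}  i≢j = contradiction refl i≢j
leftParity-anticomm (a ∷ v) {zero}  {suc j} i≢j =
  trans (sym (not-distribˡ-xor a _)) (cong not (sym (xor-identityʳ _)))
leftParity-anticomm (a ∷ v) {suc i} {zero}  i≢j =
  trans (xor-identityʳ _) (trans (sym (not-involutive _)) (cong not (not-distribˡ-xor a _)))
leftParity-anticomm (a ∷ v) {suc i} {suc j} i≢j =
  trans (cancel a _ _) (trans (leftParity-anticomm v (i≢j ∘ cong suc)) (cong not (sym (cancel a _ _))))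
  where
  cancel : ∀ a b c → (a xor b) xor (a xor c) ≡ b xor c
  cancel false b c = refl
  cancel true  b c = trans (sym (not-distribˡ-xor b (not c)))
                       (trans (cong not (sym (not-distribʳ-xor b c))) (not-involutive _))

-- The sign picked up by a product of these generators applied to the basis vector `v`, written
-- additively: `true` stands for -1.
sign : ∀ {n} → Vertex n → List (Fin n) → Bool
sign v []      = false
sign v (i ∷ W) = leftParity v i xor sign (flip v i) W

sign-swap : ∀ {n} (v : Vertex n) {i j} W → i ≢ j → sign v (i ∷ j ∷ W) ≡ not (sign v (j ∷ i ∷ W))
sign-swap v {i} {j} W i≢j = begin
  leftParity v i xor (leftParity (flip v i) j xor sign (flip (flip v i) j) W)
    ≡⟨ xor-assoc (leftParity v i) _ _ ⟨
  (leftParity v i xor leftParity (flip v i) j) xor sign (flip (flip v i) j) W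
    ≡⟨ cong₂ _xor_ (leftParity-anticomm v i≢j) (cong (λ u → sign u W) (flip-comm v i j)) ⟩
  not (leftParity v j xor leftParity (flip v j) i) xor sign (flip (flip v j) i) W
    ≡⟨ not-distribˡ-xor (leftParity v j xor leftParity (flip v j) i) _ ⟨
  not ((leftParity v j xor leftParity (flip v j) i) xor sign (flip (flip v j) i) W)
    ≡⟨ cong not (xor-assoc (leftParity v j) _ _) ⟩
  not (sign v (j ∷ i ∷ W)) ∎
  where open ≡-Reasoning

sign-cancel : ∀ {n} (v : Vertex n) i W → sign v (i ∷ i ∷ W) ≡ sign v W
sign-cancel v i W = begin
  leftParity v i xor (leftParity (flip v i) i xor sign (flip (flip v i) i) W)
    ≡⟨ cong₂ (λ a u → leftParity v i xor (a xor sign u W)) (leftParity-update v i _) (flip-flip v i) ⟩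
  leftParity v i xor (leftParity v i xor sign v W)
    ≡⟨ xor-assoc (leftParity v i) _ _ ⟨
  (leftParity v i xor leftParity v i) xor sign v W
    ≡⟨ cong (_xor sign v W) (xor-same (leftParity v i)) ⟩
  sign v W ∎
  where open ≡-Reasoning

-- Chord diagrams and the parity of their crossings

extract : ∀ {m} → Fin m → List (Fin m) → Maybe (Bool × List (Fin m))
extract a []      = nothing
extract a (b ∷ W) with a ≟ b
... | yes _ = just (false , W)
... | no _ with extract a W
...   | nothing       = nothing
...   | just (s , W′) = just (not s , b ∷ W′)

-- The first argument is fuel: half the length of the word suffices.
crossingParity : ∀ {m} → ℕ → List (Fin m) → Maybe Bool
crossingParity _       []      = just false
crossingParity zero    (a ∷ W) = nothing
crossingParity (suc f) (a ∷ W) with extract a W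
... | nothing       = nothing
... | just (s , W′) with crossingParity f W′
...   | nothing = nothing
...   | just t  = just (s xor t)

module _ {m n} (x : Fin m → Fin n) (x-inj : ∀ {i j} → x i ≡ x j → i ≡ j) where

  -- The front letter is moved right until it meets its next copy. Each letter passed costs one sign
  -- change by `sign-swap`, and `s` records the parity of these; the two adjacent copies then
  -- cancel.
  sign-extract : ∀ (v : Vertex n) a W {s W′} → extract a W ≡ just (s , W′) →
    sign v (map x (a ∷ W)) ≡ s xor sign v (map x W′)
  sign-extract v a (b ∷ W) eq with a ≟ b
  sign-extract v a (.a ∷ W) refl | yes refl = sign-cancel v (x a) (map x W)
  ... | no a≢b with extract a W in eq′
  sign-extract v a (b ∷ W) refl | no a≢b | just (s , W′) = begin
    sign v (x a ∷ x b ∷ map x W)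
      ≡⟨ sign-swap v (map x W) (a≢b ∘ x-inj) ⟩
    not (leftParity v (x b) xor sign (flip v (x b)) (x a ∷ map x W))
      ≡⟨ cong (λ t → not (leftParity v (x b) xor t)) (sign-extract (flip v (x b)) a W eq′) ⟩
    not (leftParity v (x b) xor (s xor sign (flip v (x b)) (map x W′)))
      ≡⟨ shuffle (leftParity v (x b)) s _ ⟩
    not s xor sign v (x b ∷ map x W′) ∎
    where
    open ≡-Reasoning
    shuffle : ∀ a b c → not (a xor (b xor c)) ≡ not b xor (a xor c)
    shuffle a true  c = trans (cong not (sym (not-distribʳ-xor a c))) (not-involutive _)
    shuffle a false c = refl

  -- When every letter occurs exactly twice, a chord nested under the one being removed is passed at
  -- both ends and a crossing chord at one end, so the accumulated parity is that of the crossings.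
  -- It does not depend on the starting vertex `v`.
  sign-crossingParity : ∀ f (v : Vertex n) W {s} → crossingParity f W ≡ just s → sign v (map x W) ≡ s
  sign-crossingParity zero    v []      refl = refl
  sign-crossingParity (suc f) v []      refl = refl
  sign-crossingParity (suc f) v (a ∷ W) eq with extract a W in eq₁
  ... | just (s , W′) with crossingParity f W′ in eq₂
  sign-crossingParity (suc f) v (a ∷ W) refl | just (s , W′) | just t =
    trans (sign-extract v a W eq₁) (cong (s xor_) (sign-crossingParity f v W′ eq₂))

-- Cyclic sequences of five sets

infix 4 _⊆_
_⊆_ : ∀ {n} → Vertex n → Vertex n → Set
D ⊆ A = ∀ i → lookup D i ≡ true → lookup A i ≡ true

∉-⊆ : ∀ {n} (D A : Vertex n) i → D ⊆ A → lookup A i ≡ false → lookup D i ≡ false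
∉-⊆ D A i D⊆A i∉A with lookup D i in eq
... | true  = ⊥-elim (true≢false (D⊆A i eq) i∉A)
... | false = refl

nxt : Fin 5 → Fin 5
nxt 0F = 1F
nxt 1F = 2F
nxt 2F = 3F
nxt 3F = 4F
nxt 4F = 0F

nxt⁵ : ∀ j → nxt (nxt (nxt (nxt (nxt j)))) ≡ j
nxt⁵ 0F = refl
nxt⁵ 1F = refl
nxt⁵ 2F = refl
nxt⁵ 3F = refl
nxt⁵ 4F = refl

-- A 10-cycle seen from its upper sets: step `j` removes `x j` and then inserts `y j`. Agreement of
-- `D j` and `D k` off `B l` means that their symmetric difference lies inside `B l`, so `unique` is
-- what the independence of the vectors of `B l` yields for two sets with the same sum.
record SwapCycle (n : ℕ) : Set where
  field
    B D : Fin 5 → Vertex n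
    x y : Fin 5 → Fin n
    p   : Bool
    step : ∀ j → B (nxt j) ≡ flip (flip (B j) (x j)) (y j)
    D⊆B : ∀ j → D j ⊆ B j
    x∈D : ∀ j → lookup (D j) (x j) ≡ true
    y∈D : ∀ j → lookup (D (nxt j)) (y j) ≡ true
    x≢y : ∀ j → x j ≢ y j
    y≢x : ∀ j → y j ≢ x (nxt j)
    x-parity : ∀ j → leftParity (B j) (x j) ≡ p
    y-parity : ∀ j → leftParity (B (nxt j)) (y j) ≡ p
    unique : ∀ j k l →
      (∀ i → lookup (B l) i ≡ false → lookup (D j) i ≡ lookup (D k) i) → D j ≡ D k

word : (τ : Fin 5 → Fin 5) → List (Fin 5)
word τ = 0F ∷ τ 0F ∷ 1F ∷ τ 1F ∷ 2F ∷ τ 2F ∷ 3F ∷ τ 3F ∷ 4F ∷ τ 4F ∷ []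

module _ {n} (C : SwapCycle n) where
  open SwapCycle C

  ∉B⇒∉D : ∀ j i → lookup (B j) i ≡ false → lookup (D j) i ≡ false
  ∉B⇒∉D j i = ∉-⊆ (D j) (B j) i (D⊆B j)

  x∈B : ∀ j → lookup (B j) (x j) ≡ true
  x∈B j = D⊆B j (x j) (x∈D j)

  y∈B : ∀ j → lookup (B (nxt j)) (y j) ≡ true
  y∈B j = D⊆B (nxt j) (y j) (y∈D j)

  unmoved : ∀ j {i} → i ≢ x j → i ≢ y j → lookup (B (nxt j)) i ≡ lookup (B j) i
  unmoved j {i} i≢x i≢y =
    trans (cong (λ v → lookup v i) (step j)) (trans (lookup-flip′ (flip (B j) (x j)) i≢y) (lookup-flip′ (B j) i≢x))

  x∉B : ∀ j → lookup (B (nxt j)) (x j) ≡ false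
  x∉B j = trans (cong (λ v → lookup v (x j)) (step j))
    (trans (lookup-flip′ (flip (B j) (x j)) (x≢y j)) (trans (lookup-flip (B j) (x j)) (cong not (x∈B j))))

  stays-out : ∀ j {i} → lookup (B j) i ≡ false → i ≢ y j → lookup (B (nxt j)) i ≡ false
  stays-out j {i} i∉B i≢y with i ≟ x j
  ... | yes refl = ⊥-elim (true≢false (x∈B j) i∉B)
  ... | no i≢x   = trans (unmoved j i≢x i≢y) i∉B

  was-out : ∀ j {i} → lookup (B (nxt j)) i ≡ false → i ≡ x j ⊎ lookup (B j) i ≡ false
  was-out j {i} i∉B with i ≟ x j | i ≟ y j
  ... | yes i≡x | _        = inj₁ i≡x
  ... | no _    | yes refl = ⊥-elim (true≢false (y∈B j) i∉B)
  ... | no i≢x  | no i≢y   = inj₂ (trans (sym (unmoved j i≢x i≢y)) i∉B)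

  x≢x¹ : ∀ j → x j ≢ x (nxt j)
  x≢x¹ j eq = true≢false (x∈B (nxt j)) (subst (λ i → lookup (B (nxt j)) i ≡ false) eq (x∉B j))

  -- To be removed again at step j+2, `x j` would have to be inserted at step j+1, and `y≢x` forbids
  -- removing an element immediately after its insertion.
  x≢x² : ∀ j → x j ≢ x (nxt (nxt j))
  x≢x² j eq = true≢false (x∈B (nxt (nxt j)))
    (subst (λ i → lookup (B (nxt (nxt j))) i ≡ false) eq
      (stays-out (nxt j) (x∉B j) (λ eq′ → y≢x (nxt j) (trans (sym eq′) eq))))

  -- Any two distinct indices modulo 5 are at cyclic distance 1 or 2.
  x-injective : ∀ {i j} → x i ≡ x j → i ≡ j
  x-injective {0F} {0F} eq = refl
  x-injective {0F} {1F} eq = ⊥-elim (x≢x¹ 0F eq)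
  x-injective {0F} {2F} eq = ⊥-elim (x≢x² 0F eq)
  x-injective {0F} {3F} eq = ⊥-elim (x≢x² 3F (sym eq))
  x-injective {0F} {4F} eq = ⊥-elim (x≢x¹ 4F (sym eq))
  x-injective {1F} {0F} eq = ⊥-elim (x≢x¹ 0F (sym eq))
  x-injective {1F} {1F} eq = refl
  x-injective {1F} {2F} eq = ⊥-elim (x≢x¹ 1F eq)
  x-injective {1F} {3F} eq = ⊥-elim (x≢x² 1F eq)
  x-injective {1F} {4F} eq = ⊥-elim (x≢x² 4F (sym eq))
  x-injective {2F} {0F} eq = ⊥-elim (x≢x² 0F (sym eq))
  x-injective {2F} {1F} eq = ⊥-elim (x≢x¹ 1F (sym eq))
  x-injective {2F} {2F} eq = refl
  x-injective {2F} {3F} eq = ⊥-elim (x≢x¹ 2F eq)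
  x-injective {2F} {4F} eq = ⊥-elim (x≢x² 2F eq)
  x-injective {3F} {0F} eq = ⊥-elim (x≢x² 3F eq)
  x-injective {3F} {1F} eq = ⊥-elim (x≢x² 1F (sym eq))
  x-injective {3F} {2F} eq = ⊥-elim (x≢x¹ 2F (sym eq))
  x-injective {3F} {3F} eq = refl
  x-injective {3F} {4F} eq = ⊥-elim (x≢x¹ 3F eq)
  x-injective {4F} {0F} eq = ⊥-elim (x≢x¹ 4F eq)
  x-injective {4F} {1F} eq = ⊥-elim (x≢x² 4F eq)
  x-injective {4F} {2F} eq = ⊥-elim (x≢x² 2F (sym eq))
  x-injective {4F} {3F} eq = ⊥-elim (x≢x¹ 3F (sym eq))
  x-injective {4F} {4F} eq = refl

  -- The length of the chord that joins the removal of `x j` to its reinsertion. Three values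
  -- suffice: `x≢y` excludes reinsertion at step j and `y≢x` excludes it at step j+4.
  ReturnsAfter : Fin 3 → Fin 5 → Set
  ReturnsAfter 0F j = x j ≡ y (nxt j)
  ReturnsAfter 1F j = x j ≡ y (nxt (nxt j))
  ReturnsAfter 2F j = x j ≡ y (nxt (nxt (nxt j)))

  -- Without a reinsertion `x j` would still be missing after five steps, when the sequence is back
  -- at `B j`, which contains it.
  returns : ∀ j → ∃[ a ] ReturnsAfter a j
  returns j with x j ≟ y (nxt j) | x j ≟ y (nxt (nxt j)) | x j ≟ y (nxt (nxt (nxt j)))
  ... | yes eq | _      | _      = 0F , eq
  ... | no _   | yes eq | _      = 1F , eq
  ... | no _   | no _   | yes eq = 2F , eq
  ... | no ≢₁  | no ≢₂  | no ≢₃  = ⊥-elim (true≢false (x∈B j)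
    (subst (λ k → lookup (B k) (x j) ≡ false) (nxt⁵ j)
      (stays-out _ (stays-out _ (stays-out _ (stays-out _ (x∉B j) ≢₁) ≢₂) ≢₃)
        (λ eq → y≢x _ (trans (sym eq) (cong x (sym (nxt⁵ j))))))))

  D-changes : ∀ j → D j ≢ D (nxt j)
  D-changes j eq = true≢false (x∈D j)
    (trans (cong (λ v → lookup v (x j)) eq) (∉B⇒∉D (nxt j) (x j) (x∉B j)))

  -- D j + D (j+1) is a vanishing sum inside B (j+2).
  ¬short-then-long : ∀ j → ReturnsAfter 0F j → ReturnsAfter 2F (nxt j) → ⊥
  ¬short-then-long j r₀ r₂ = D-changes j (unique j (nxt j) (nxt (nxt j)) same)
    where
    same : ∀ i → lookup (B (nxt (nxt j))) i ≡ false → lookup (D j) i ≡ lookup (D (nxt j)) i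
    same i i∉B with was-out (nxt j) i∉B
    -- Here `i` is `x (nxt j)`. By `r₂` it is reinserted at step j+4, hence belongs to D (j+5),
    -- which is `D j`; it also belongs to `D (nxt j)`.
    ... | inj₁ refl = trans
      (subst₂ (λ k i → lookup (D k) i ≡ true) (nxt⁵ j) (sym r₂) (y∈D (nxt (nxt (nxt (nxt j))))))
      (sym (x∈D (nxt j)))
    ... | inj₂ i∉B₁ with was-out j i∉B₁
    ...   | inj₁ refl = ⊥-elim
      (true≢false (y∈B (nxt j)) (subst (λ i → lookup (B (nxt (nxt j))) i ≡ false) r₀ i∉B))
    ...   | inj₂ i∉B₀ = trans (∉B⇒∉D j i i∉B₀) (sym (∉B⇒∉D (nxt j) i i∉B₁))

  -- Here B j is {x j, x (j+1), x (j+2)} up to a common part, and D j contains x j and x (j+2).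
  module Pentagon (r : ∀ j → ReturnsAfter 1F j) where

    third∈D : ∀ j → lookup (D j) (x (nxt (nxt j))) ≡ true
    third∈D j = subst₂ (λ k i → lookup (D k) i ≡ true) (nxt⁵ j) (sym (r (nxt (nxt j))))
      (y∈D (nxt (nxt (nxt (nxt j)))))

    -- Of the three elements removed on the way from B j to B (j+3), the first one, `x j`, is
    -- already back, since `r` has it reinserted at step j+2.
    outside : ∀ j i → lookup (B (nxt (nxt (nxt j)))) i ≡ false →
      i ≡ x (nxt (nxt j)) ⊎ i ≡ x (nxt j) ⊎
      (lookup (B j) i ≡ false × lookup (B (nxt j)) i ≡ false × lookup (B (nxt (nxt j))) i ≡ false)
    outside j i i∉B₃ with was-out (nxt (nxt j)) i∉B₃
    ... | inj₁ eq = inj₁ eq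
    ... | inj₂ i∉B₂ with was-out (nxt j) i∉B₂
    ...   | inj₁ eq = inj₂ (inj₁ eq)
    ...   | inj₂ i∉B₁ with was-out j i∉B₁
    ...     | inj₁ refl = ⊥-elim (true≢false (y∈B (nxt (nxt j)))
                (subst (λ i → lookup (B (nxt (nxt (nxt j)))) i ≡ false) (r j) i∉B₃))
    ...     | inj₂ i∉B₀ = inj₂ (inj₂ (i∉B₀ , i∉B₁ , i∉B₂))

    -- Otherwise D j and D (j+2) would agree off B (j+3): both contain x (j+2) and both miss x
    -- (j+1). They would then be equal, although `x j` is in D j and not in B (j+2).
    middle∈D : ∀ j → lookup (D j) (x (nxt j)) ≡ true
    middle∈D j with lookup (D j) (x (nxt j)) in eq
    ... | true  = refl
    ... | false = ⊥-elim (true≢false (x∈D j)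
      (trans (cong (λ v → lookup v (x j)) (unique j (nxt (nxt j)) (nxt (nxt (nxt j))) same))
        (∉B⇒∉D _ _ (stays-out (nxt j) (x∉B j)
          -- The element inserted at step j+1 is x (j+4) by `r`, and this differs from its cyclic
          -- successor `x j`.
          (λ eq′ → x≢x¹ (nxt (nxt (nxt (nxt j))))
            (trans (r _) (trans (cong (y ∘ nxt) (nxt⁵ j)) (trans (sym eq′) (cong x (sym (nxt⁵ j)))))))))))
      where
      same : ∀ i → lookup (B (nxt (nxt (nxt j)))) i ≡ false →
        lookup (D j) i ≡ lookup (D (nxt (nxt j))) i
      same i i∉B with outside j i i∉B
      ... | inj₁ refl = trans (third∈D j) (sym (x∈D (nxt (nxt j))))
      ... | inj₂ (inj₁ refl) = trans eq (sym (∉B⇒∉D _ _ (x∉B (nxt j))))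
      ... | inj₂ (inj₂ (i∉B₀ , _ , i∉B₂)) = trans (∉B⇒∉D _ i i∉B₀) (sym (∉B⇒∉D _ i i∉B₂))

    -- With `middle∈D`, both D 0 and D 1 contain `x 1F` and `x 2F`, the only places off `B 3F` where
    -- they could differ; so they are equal, against `D-changes`.
    ¬pentagon : ⊥
    ¬pentagon = D-changes 0F (unique 0F 1F 3F same)
      where
      same : ∀ i → lookup (B 3F) i ≡ false → lookup (D 0F) i ≡ lookup (D 1F) i
      same i i∉B with outside 0F i i∉B
      ... | inj₁ refl = trans (third∈D 0F) (sym (middle∈D 1F))
      ... | inj₂ (inj₁ refl) = trans (middle∈D 0F) (sym (x∈D 1F))
      ... | inj₂ (inj₂ (i∉B₀ , i∉B₁ , _)) = trans (∉B⇒∉D _ i i∉B₀) (sym (∉B⇒∉D _ i i∉B₁))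

  -- The two edges of a step have the same left parity `p`, so their contributions cancel. The left
  -- parity of `y j` may be read at either end of its edge, because a coordinate does not count
  -- itself. Going once around therefore gives the trivial sign.
  sign-step : ∀ j W → sign (B j) (x j ∷ y j ∷ W) ≡ sign (B (nxt j)) W
  sign-step j W = begin
    leftParity (B j) (x j) xor (leftParity (flip (B j) (x j)) (y j) xor sign (flip (flip (B j) (x j)) (y j)) W)
      ≡⟨ cong₂ (λ a b → a xor (b xor sign (flip (flip (B j) (x j)) (y j)) W)) (x-parity j)
           (trans (sym (leftParity-update (flip (B j) (x j)) (y j) _))
             (trans (cong (λ v → leftParity v (y j)) (sym (step j))) (y-parity j))) ⟩
    p xor (p xor sign (flip (flip (B j) (x j)) (y j)) W)
      ≡⟨ xor-assoc p p _ ⟨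
    (p xor p) xor sign (flip (flip (B j) (x j)) (y j)) W
      ≡⟨ cong₂ (λ a v → a xor sign v W) (xor-same p) (sym (step j)) ⟩
    sign (B (nxt j)) W ∎
    where open ≡-Reasoning

  round : List (Fin n)
  round = x 0F ∷ y 0F ∷ x 1F ∷ y 1F ∷ x 2F ∷ y 2F ∷ x 3F ∷ y 3F ∷ x 4F ∷ y 4F ∷ []

  sign-round : sign (B 0F) round ≡ false
  sign-round =
    trans (sign-step 0F (x 1F ∷ y 1F ∷ x 2F ∷ y 2F ∷ x 3F ∷ y 3F ∷ x 4F ∷ y 4F ∷ []))
    (trans (sign-step 1F (x 2F ∷ y 2F ∷ x 3F ∷ y 3F ∷ x 4F ∷ y 4F ∷ []))
    (trans (sign-step 2F (x 3F ∷ y 3F ∷ x 4F ∷ y 4F ∷ []))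
    (trans (sign-step 3F (x 4F ∷ y 4F ∷ [])) (sign-step 4F []))))

  ¬odd-word : (τ : Fin 5 → Fin 5) → (∀ j → y j ≡ x (τ j)) →
    crossingParity 5 (word τ) ≡ just true → ⊥
  ¬odd-word τ y≡xτ odd =
    true≢false (sign-crossingParity x x-injective 5 (B 0F) (word τ) odd)
      (trans (cong (sign (B 0F)) (sym round≡word)) sign-round)
    where
    round≡word : round ≡ map x (word τ)
    round≡word rewrite y≡xτ 0F | y≡xτ 1F | y≡xτ 2F | y≡xτ 3F | y≡xτ 4F = refl

  -- The first twenty clauses exclude two elements returning at the same step and a short chord
  -- followed by a long one. What survives is the constant patterns and the five rotations of
  -- 0,1,1,1,2; all of these except the constant 1 have an odd number of crossings, computed by
  -- `refl`.
  ¬returns : ∀ a b c d e → ReturnsAfter a 0F → ReturnsAfter b 1F → ReturnsAfter c 2F →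
    ReturnsAfter d 3F → ReturnsAfter e 4F → ⊥
  ¬returns 1F 0F _ _ _ r₀ r₁ _ _ _ = x≢x¹ 0F (trans r₀ (sym r₁))
  ¬returns 2F 1F _ _ _ r₀ r₁ _ _ _ = x≢x¹ 0F (trans r₀ (sym r₁))
  ¬returns 2F _ 0F _ _ r₀ _ r₂ _ _ = x≢x² 0F (trans r₀ (sym r₂))
  ¬returns 0F 2F _ _ _ r₀ r₁ _ _ _ = ¬short-then-long 0F r₀ r₁
  ¬returns _ 1F 0F _ _ _ r₁ r₂ _ _ = x≢x¹ 1F (trans r₁ (sym r₂))
  ¬returns _ 2F 1F _ _ _ r₁ r₂ _ _ = x≢x¹ 1F (trans r₁ (sym r₂))
  ¬returns _ 2F _ 0F _ _ r₁ _ r₃ _ = x≢x² 1F (trans r₁ (sym r₃))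
  ¬returns _ 0F 2F _ _ _ r₁ r₂ _ _ = ¬short-then-long 1F r₁ r₂
  ¬returns _ _ 1F 0F _ _ _ r₂ r₃ _ = x≢x¹ 2F (trans r₂ (sym r₃))
  ¬returns _ _ 2F 1F _ _ _ r₂ r₃ _ = x≢x¹ 2F (trans r₂ (sym r₃))
  ¬returns _ _ 2F _ 0F _ _ r₂ _ r₄ = x≢x² 2F (trans r₂ (sym r₄))
  ¬returns _ _ 0F 2F _ _ _ r₂ r₃ _ = ¬short-then-long 2F r₂ r₃
  ¬returns _ _ _ 1F 0F _ _ _ r₃ r₄ = x≢x¹ 3F (trans r₃ (sym r₄))
  ¬returns _ _ _ 2F 1F _ _ _ r₃ r₄ = x≢x¹ 3F (trans r₃ (sym r₄))
  ¬returns 0F _ _ 2F _ r₀ _ _ r₃ _ = x≢x² 3F (trans r₃ (sym r₀))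
  ¬returns _ _ _ 0F 2F _ _ _ r₃ r₄ = ¬short-then-long 3F r₃ r₄
  ¬returns 0F _ _ _ 1F r₀ _ _ _ r₄ = x≢x¹ 4F (trans r₄ (sym r₀))
  ¬returns 1F _ _ _ 2F r₀ _ _ _ r₄ = x≢x¹ 4F (trans r₄ (sym r₀))
  ¬returns _ 0F _ _ 2F _ r₁ _ _ r₄ = x≢x² 4F (trans r₄ (sym r₁))
  ¬returns 2F _ _ _ 0F r₀ _ _ _ r₄ = ¬short-then-long 4F r₄ r₀
  -- All five chords are diameters, with ten crossings. This number is even, so the sign gives no
  -- contradiction and the independence argument takes its place.
  ¬returns 1F 1F 1F 1F 1F r₀ r₁ r₂ r₃ r₄ = Pentagon.¬pentagon λ { 0F → r₀ ; 1F → r₁ ; 2F → r₂ ; 3F → r₃ ; 4F → r₄ }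
  ¬returns 0F 0F 0F 0F 0F r₀ r₁ r₂ r₃ r₄ = ¬odd-word (λ { 0F → 4F ; 1F → 0F ; 2F → 1F ; 3F → 2F ; 4F → 3F })
    (λ { 0F → sym r₄ ; 1F → sym r₀ ; 2F → sym r₁ ; 3F → sym r₂ ; 4F → sym r₃ }) refl
  ¬returns 2F 2F 2F 2F 2F r₀ r₁ r₂ r₃ r₄ = ¬odd-word (λ { 0F → 2F ; 1F → 3F ; 2F → 4F ; 3F → 0F ; 4F → 1F })
    (λ { 0F → sym r₂ ; 1F → sym r₃ ; 2F → sym r₄ ; 3F → sym r₀ ; 4F → sym r₁ }) refl
  ¬returns 0F 1F 1F 1F 2F r₀ r₁ r₂ r₃ r₄ = ¬odd-word (λ { 0F → 3F ; 1F → 0F ; 2F → 4F ; 3F → 1F ; 4F → 2F })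
    (λ { 0F → sym r₃ ; 1F → sym r₀ ; 2F → sym r₄ ; 3F → sym r₁ ; 4F → sym r₂ }) refl
  ¬returns 2F 0F 1F 1F 1F r₀ r₁ r₂ r₃ r₄ = ¬odd-word (λ { 0F → 3F ; 1F → 4F ; 2F → 1F ; 3F → 0F ; 4F → 2F })
    (λ { 0F → sym r₃ ; 1F → sym r₄ ; 2F → sym r₁ ; 3F → sym r₀ ; 4F → sym r₂ }) refl
  ¬returns 1F 2F 0F 1F 1F r₀ r₁ r₂ r₃ r₄ = ¬odd-word (λ { 0F → 3F ; 1F → 4F ; 2F → 0F ; 3F → 2F ; 4F → 1F })
    (λ { 0F → sym r₃ ; 1F → sym r₄ ; 2F → sym r₀ ; 3F → sym r₂ ; 4F → sym r₁ }) refl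
  ¬returns 1F 1F 2F 0F 1F r₀ r₁ r₂ r₃ r₄ = ¬odd-word (λ { 0F → 2F ; 1F → 4F ; 2F → 0F ; 3F → 1F ; 4F → 3F })
    (λ { 0F → sym r₂ ; 1F → sym r₄ ; 2F → sym r₀ ; 3F → sym r₁ ; 4F → sym r₃ }) refl
  ¬returns 1F 1F 1F 2F 0F r₀ r₁ r₂ r₃ r₄ = ¬odd-word (λ { 0F → 4F ; 1F → 3F ; 2F → 0F ; 3F → 1F ; 4F → 2F })
    (λ { 0F → sym r₄ ; 1F → sym r₃ ; 2F → sym r₀ ; 3F → sym r₁ ; 4F → sym r₂ }) refl

  ¬swapCycle : ⊥
  ¬swapCycle with returns 0F | returns 1F | returns 2F | returns 3F | returns 4F
  ... | a , r₀ | b , r₁ | c , r₂ | d , r₃ | e , r₄ = ¬returns a b c d e r₀ r₁ r₂ r₃ r₄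

-- Finite sums and averaging

private
  variable
    X Y Z : Set

∑ : List X → (X → ℕ) → ℕ
∑ xs f = sum (map f xs)

𝟙 : Bool → ℕ
𝟙 b = if b then 1 else 0

∑-cong : ∀ (xs : List X) {f g : X → ℕ} → (∀ x → f x ≡ g x) → ∑ xs f ≡ ∑ xs g
∑-cong []       eq = refl
∑-cong (x ∷ xs) eq = cong₂ _+_ (eq x) (∑-cong xs eq)

∑-mono : ∀ (xs : List X) {f g : X → ℕ} → (∀ x → f x ≤ g x) → ∑ xs f ≤ ∑ xs g
∑-mono []       le = z≤n
∑-mono (x ∷ xs) le = +-mono-≤ (le x) (∑-mono xs le)

∑-+ : ∀ (xs : List X) (f g : X → ℕ) → ∑ xs (λ x → f x + g x) ≡ ∑ xs f + ∑ xs g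
∑-+ []       f g = refl
∑-+ (x ∷ xs) f g = trans (cong (f x + g x +_) (∑-+ xs f g))
  (solve 4 (λ a b c d → a :+ b :+ (c :+ d) := a :+ c :+ (b :+ d)) refl (f x) (g x) (∑ xs f) (∑ xs g))

∑-*ˡ : ∀ (xs : List X) c (f : X → ℕ) → ∑ xs (λ x → c * f x) ≡ c * ∑ xs f
∑-*ˡ []       c f = sym (*-zeroʳ c)
∑-*ˡ (x ∷ xs) c f = trans (cong (c * f x +_) (∑-*ˡ xs c f)) (sym (*-distribˡ-+ c (f x) _))

∑-const : ∀ (xs : List X) c → ∑ xs (λ _ → c) ≡ length xs * c
∑-const []       c = refl
∑-const (x ∷ xs) c = cong (c +_) (∑-const xs c)

∑-++ : ∀ (xs ys : List X) f → ∑ (xs ++ ys) f ≡ ∑ xs f + ∑ ys f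
∑-++ xs ys f = trans (cong sum (map-++ f xs ys)) (sum-++ (map f xs) (map f ys))

∑-map : ∀ (g : Y → X) xs f → ∑ (map g xs) f ≡ ∑ xs (f ∘ g)
∑-map g xs f = cong sum (sym (map-∘ xs))

∑-swap : ∀ (xs : List X) (ys : List Y) (f : X → Y → ℕ) →
  ∑ xs (λ x → ∑ ys (f x)) ≡ ∑ ys (λ y → ∑ xs (λ x → f x y))
∑-swap []       ys f = sym (trans (∑-const ys 0) (*-zeroʳ (length ys)))
∑-swap (x ∷ xs) ys f = trans (cong (∑ ys (f x) +_) (∑-swap xs ys f))
  (sym (∑-+ ys (f x) (λ y → ∑ xs (λ x → f x y))))

∑-product : ∀ (g : X → Y → Z) xs ys f →
  ∑ (cartesianProductWith g xs ys) f ≡ ∑ xs (λ x → ∑ ys (λ y → f (g x y)))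
∑-product g []       ys f = refl
∑-product g (x ∷ xs) ys f = trans (cong sum (map-++ f (map (g x) ys) _))
  (trans (sum-++ (map f (map (g x) ys)) _)
    (cong₂ _+_ (cong sum (sym (map-∘ ys))) (∑-product g xs ys f)))

∑-above-average : ∀ (xs : List X) f c → length xs * c < ∑ xs f → ∃[ x ] c < f x
∑-above-average (x ∷ xs) f c lt with f x ≤? c
... | no ≰c  = x , ≰⇒> ≰c
... | yes ≤c = ∑-above-average xs f c
  (+-cancelˡ-< c _ _ (<-≤-trans lt (+-monoˡ-≤ (∑ xs f) ≤c)))

-- Vectors over the field of two elements and their truncations

_≟ᵛ_ : ∀ {n} (u v : Vertex n) → Dec (u ≡ v)
_≟ᵛ_ = ≡-dec Bool._≟_

𝟎 : ∀ {n} → Vertex n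
𝟎 = replicate _ false

infixl 6 _⊕_
_⊕_ : ∀ {n} → Vertex n → Vertex n → Vertex n
_⊕_ = zipWith _xor_

⊕-self : ∀ {n} (u : Vertex n) → u ⊕ u ≡ 𝟎
⊕-self []      = refl
⊕-self (a ∷ u) = cong₂ _∷_ (Bool.xor-same a) (⊕-self u)

⊕-zero⇒≡ : ∀ {n} (u v : Vertex n) → u ⊕ v ≡ 𝟎 → u ≡ v
⊕-zero⇒≡ []          []          eq = refl
⊕-zero⇒≡ (false ∷ u) (false ∷ v) eq = cong (false ∷_) (⊕-zero⇒≡ u v (∷-injectiveʳ eq))
⊕-zero⇒≡ (true ∷ u)  (true ∷ v)  eq = cong (true ∷_) (⊕-zero⇒≡ u v (∷-injectiveʳ eq))

⊕-interchange : ∀ {n} (a b c d : Vertex n) → (a ⊕ b) ⊕ (c ⊕ d) ≡ (a ⊕ c) ⊕ (b ⊕ d)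
⊕-interchange []      []      []      []      = refl
⊕-interchange (a ∷ u) (b ∷ v) (c ∷ w) (d ∷ z) = cong₂ _∷_ (bit a b c d) (⊕-interchange u v w z)
  where
  open import Algebra.Properties.CommutativeSemigroup
    (CommutativeRing.+-commutativeSemigroup Bool.xor-∧-commutativeRing) using () renaming (interchange to bit)

-- The tail is zeroed and not cut off, so that the type stays the same while `k` varies with the
-- size of the set considered.
trunc : ∀ {n} → ℕ → Vertex n → Vertex n
trunc zero    v       = 𝟎
trunc (suc k) []      = []
trunc (suc k) (a ∷ v) = a ∷ trunc k v

trunc-⊕ : ∀ {n} k (u v : Vertex n) → trunc k (u ⊕ v) ≡ trunc k u ⊕ trunc k v
trunc-⊕ zero    u       v       = sym (⊕-self 𝟎)
trunc-⊕ (suc k) []      []      = refl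
trunc-⊕ (suc k) (a ∷ u) (b ∷ v) = cong ((a xor b) ∷_) (trunc-⊕ k u v)

allVertices-length : ∀ n → length (allVertices n) ≡ 2 ^ n
allVertices-length zero    = refl
allVertices-length (suc n) = trans (length-++ (map (false ∷_) (allVertices n)))
  (cong₂ _+_ (trans (length-map _ (allVertices n)) (allVertices-length n))
    (trans (trans (length-map _ (allVertices n)) (allVertices-length n)) (sym (+-identityʳ _))))

∑-allVertices : ∀ n f → ∑ (allVertices (suc n)) f ≡
  ∑ (allVertices n) (f ∘ (false ∷_)) + ∑ (allVertices n) (f ∘ (true ∷_))
∑-allVertices n f = trans (∑-++ (map (false ∷_) (allVertices n)) _ f)
  (cong₂ _+_ (∑-map _ (allVertices n) f) (∑-map _ (allVertices n) f))

-- A fibre has 2^(n-k) elements: each of the `k` retained bits leaves only one half of the cube.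
-- Multiplying by `2 ^ k` avoids subtraction.
trunc-fibre : ∀ {n} k → k ≤ n → (z : Vertex n) →
  2 ^ k * ∑ (allVertices n) (λ m → 𝟙 (does (trunc k z ≟ᵛ trunc k m))) ≡ 2 ^ n
trunc-fibre {n} zero _ z = begin
  1 * ∑ (allVertices n) (λ m → 𝟙 (does (𝟎 {n} ≟ᵛ 𝟎)))
    ≡⟨ *-identityˡ _ ⟩
  ∑ (allVertices n) (λ m → 𝟙 (does (𝟎 {n} ≟ᵛ 𝟎)))
    ≡⟨ ∑-cong (allVertices n) (λ m → cong 𝟙 (dec-true (𝟎 {n} ≟ᵛ 𝟎) refl)) ⟩
  ∑ (allVertices n) (λ m → 1)
    ≡⟨ ∑-const (allVertices n) 1 ⟩
  length (allVertices n) * 1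
    ≡⟨ trans (*-identityʳ _) (allVertices-length n) ⟩
  2 ^ n ∎
  where open ≡-Reasoning
trunc-fibre {suc n} (suc k) (s≤s k≤n) (a ∷ z) = begin
  2 ^ suc k * ∑ (allVertices (suc n)) (λ m → 𝟙 (does (trunc (suc k) (a ∷ z) ≟ᵛ trunc (suc k) m)))
    ≡⟨ cong (2 ^ suc k *_) (trans (∑-allVertices n _) (halves a)) ⟩
  2 * 2 ^ k * F
    ≡⟨ *-assoc 2 (2 ^ k) F ⟩
  2 * (2 ^ k * F)
    ≡⟨ cong (2 *_) (trunc-fibre k k≤n z) ⟩
  2 ^ suc n ∎
  where
  open ≡-Reasoning
  F = ∑ (allVertices n) (λ m → 𝟙 (does (trunc k z ≟ᵛ trunc k m)))
  none : ∑ (allVertices n) (λ m → 0) ≡ 0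
  none = trans (∑-const (allVertices n) 0) (*-zeroʳ (length (allVertices n)))
  halves : ∀ a → ∑ (allVertices n) (λ m → 𝟙 (does ((a ∷ trunc k z) ≟ᵛ (false ∷ trunc k m)))) +
                 ∑ (allVertices n) (λ m → 𝟙 (does ((a ∷ trunc k z) ≟ᵛ (true ∷ trunc k m)))) ≡ F
  halves false = trans (cong (F +_) none) (+-identityʳ F)
  halves true  = cong (_+ F) none

-- Used in two ways: with the span of vectors already chosen, which a new vector must avoid, and
-- with the sums of the sets through a coordinate, among which `w` must occur.
hit : ∀ {n} → ℕ → List (Vertex n) → Vertex n → Bool
hit k L m = any (λ z → does (trunc k z ≟ᵛ trunc k m)) L

hit⁺ : ∀ {n} k {L : List (Vertex n)} {z m} → z ∈ L → trunc k z ≡ trunc k m → hit k L m ≡ true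
hit⁺ k {z ∷ L} {m = m} (here refl) eq = cong (_∨ hit k L m) (dec-true (trunc k z ≟ᵛ trunc k m) eq)
hit⁺ k {u ∷ L} {m = m} (there z∈L) eq = trans
  (cong (does (trunc k u ≟ᵛ trunc k m) ∨_) (hit⁺ k z∈L eq))
  (Bool.∨-zeroʳ _)

hit⁻ : ∀ {n} k (L : List (Vertex n)) {m} → hit k L m ≡ true → ∃[ z ] (z ∈ L × trunc k z ≡ trunc k m)
hit⁻ k (u ∷ L) {m} h with trunc k u ≟ᵛ trunc k m
... | yes eq = u , here refl , eq
... | no _ with hit⁻ k L h
...   | z , z∈L , eq = z , there z∈L , eq

module _ {n} k (k≤n : k ≤ n) where

  -- The union bound, each entry of `L` contributing one fibre.
  ∑-hit≤ : ∀ (L : List (Vertex n)) → 2 ^ k * ∑ (allVertices n) (𝟙 ∘ hit k L) ≤ length L * 2 ^ n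
  ∑-hit≤ []      = ≤-reflexive (trans (cong (2 ^ k *_)
    (trans (∑-const (allVertices n) 0) (*-zeroʳ (length (allVertices n))))) (*-zeroʳ (2 ^ k)))
  ∑-hit≤ (z ∷ L) = begin
    2 ^ k * ∑ V (λ m → 𝟙 (does (trunc k z ≟ᵛ trunc k m) ∨ hit k L m))
      ≤⟨ *-monoʳ-≤ (2 ^ k) (∑-mono V (λ m → 𝟙-∨ (does (trunc k z ≟ᵛ trunc k m)) (hit k L m))) ⟩
    2 ^ k * ∑ V (λ m → 𝟙 (does (trunc k z ≟ᵛ trunc k m)) + 𝟙 (hit k L m))
      ≡⟨ cong (2 ^ k *_) (∑-+ V _ _) ⟩
    2 ^ k * (∑ V (λ m → 𝟙 (does (trunc k z ≟ᵛ trunc k m))) + ∑ V (𝟙 ∘ hit k L))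
      ≡⟨ *-distribˡ-+ (2 ^ k) _ _ ⟩
    2 ^ k * ∑ V (λ m → 𝟙 (does (trunc k z ≟ᵛ trunc k m))) + 2 ^ k * ∑ V (𝟙 ∘ hit k L)
      ≤⟨ +-mono-≤ (≤-reflexive (trunc-fibre k k≤n z)) (∑-hit≤ L) ⟩
    2 ^ n + length L * 2 ^ n ∎
    where
    open ≤-Reasoning
    V = allVertices n
    𝟙-∨ : ∀ a b → 𝟙 (a ∨ b) ≤ 𝟙 a + 𝟙 b
    𝟙-∨ true  b = s≤s z≤n
    𝟙-∨ false b = ≤-refl

  -- Distinct truncations have disjoint fibres, so the union bound loses nothing.
  ∑-hit≥ : ∀ (L : List (Vertex n)) → AllPairs (λ z z′ → trunc k z ≢ trunc k z′) L →
    length L * 2 ^ n ≤ 2 ^ k * ∑ (allVertices n) (𝟙 ∘ hit k L)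
  ∑-hit≥ []      _ = z≤n
  ∑-hit≥ (z ∷ L) (z≢ ∷ distinct) = begin
    2 ^ n + length L * 2 ^ n
      ≤⟨ +-mono-≤ (≤-reflexive (sym (trunc-fibre k k≤n z))) (∑-hit≥ L distinct) ⟩
    2 ^ k * ∑ V (λ m → 𝟙 (does (trunc k z ≟ᵛ trunc k m))) + 2 ^ k * ∑ V (𝟙 ∘ hit k L)
      ≡⟨ *-distribˡ-+ (2 ^ k) _ _ ⟨
    2 ^ k * (∑ V (λ m → 𝟙 (does (trunc k z ≟ᵛ trunc k m))) + ∑ V (𝟙 ∘ hit k L))
      ≡⟨ cong (2 ^ k *_) (∑-+ V _ _) ⟨
    2 ^ k * ∑ V (λ m → 𝟙 (does (trunc k z ≟ᵛ trunc k m)) + 𝟙 (hit k L m))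
      ≤⟨ *-monoʳ-≤ (2 ^ k) (∑-mono V disjoint) ⟩
    2 ^ k * ∑ V (λ m → 𝟙 (does (trunc k z ≟ᵛ trunc k m) ∨ hit k L m)) ∎
    where
    open ≤-Reasoning
    V = allVertices n
    disjoint : ∀ m → 𝟙 (does (trunc k z ≟ᵛ trunc k m)) + 𝟙 (hit k L m) ≤
                     𝟙 (does (trunc k z ≟ᵛ trunc k m) ∨ hit k L m)
    disjoint m with trunc k z ≟ᵛ trunc k m
    ... | no _ = ≤-refl
    ... | yes eq with hit k L m in h
    ...   | false = ≤-refl
    ...   | true with hit⁻ k L h
    ...     | z′ , z′∈L , eq′ = ⊥-elim (All.lookup z≢ z′∈L (trans eq (sym eq′)))

-- Subsets, their vector sums and linear independence

weight : ∀ {n} → Vertex n → ℕ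
weight []          = 0
weight (true ∷ v)  = suc (weight v)
weight (false ∷ v) = weight v

weight≤ : ∀ {n} (v : Vertex n) → weight v ≤ n
weight≤ []          = z≤n
weight≤ (true ∷ v)  = s≤s (weight≤ v)
weight≤ (false ∷ v) = m≤n⇒m≤1+n (weight≤ v)

subsets : ∀ {n} → Vertex n → List (Vertex n)
subsets []          = [] ∷ []
subsets (false ∷ A) = map (false ∷_) (subsets A)
subsets (true ∷ A)  = map (false ∷_) (subsets A) ++ map (true ∷_) (subsets A)

subsets-length : ∀ {n} (A : Vertex n) → length (subsets A) ≡ 2 ^ weight A
subsets-length []          = refl
subsets-length (false ∷ A) = trans (length-map _ (subsets A)) (subsets-length A)
subsets-length (true ∷ A)  = trans (length-++ (map (false ∷_) (subsets A)))
  (cong₂ _+_ (trans (length-map _ (subsets A)) (subsets-length A))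
    (trans (trans (length-map _ (subsets A)) (subsets-length A)) (sym (+-identityʳ _))))

∷-⊆ : ∀ {n} {a b} {D A : Vertex n} → (a ≡ true → b ≡ true) → D ⊆ A → (a ∷ D) ⊆ (b ∷ A)
∷-⊆ a⇒b D⊆A zero    = a⇒b
∷-⊆ a⇒b D⊆A (suc i) = D⊆A i

∈-subsets⁺ : ∀ {n} (D A : Vertex n) → D ⊆ A → D ∈ subsets A
∈-subsets⁺ []          []          D⊆A = here refl
∈-subsets⁺ (false ∷ D) (false ∷ A) D⊆A = ∈-map⁺ (false ∷_) (∈-subsets⁺ D A (D⊆A ∘ suc))
∈-subsets⁺ (true ∷ D)  (false ∷ A) D⊆A with () ← D⊆A zero refl
∈-subsets⁺ (false ∷ D) (true ∷ A)  D⊆A = ∈-++⁺ˡ (∈-map⁺ (false ∷_) (∈-subsets⁺ D A (D⊆A ∘ suc)))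
∈-subsets⁺ (true ∷ D)  (true ∷ A)  D⊆A =
  ∈-++⁺ʳ (map (false ∷_) (subsets A)) (∈-map⁺ (true ∷_) (∈-subsets⁺ D A (D⊆A ∘ suc)))

∈-subsets⁻ : ∀ {n} (A : Vertex n) {D} → D ∈ subsets A → D ⊆ A
∈-subsets⁻ []          (here refl) ()
∈-subsets⁻ (false ∷ A) D∈ with ∈-map⁻ (false ∷_) D∈
... | D′ , D′∈ , refl = ∷-⊆ (λ ()) (∈-subsets⁻ A D′∈)
∈-subsets⁻ (true ∷ A) D∈ with ∈-++⁻ (map (false ∷_) (subsets A)) D∈
... | inj₁ D∈ˡ with ∈-map⁻ (false ∷_) D∈ˡ
...   | D′ , D′∈ , refl = ∷-⊆ (λ ()) (∈-subsets⁻ A D′∈)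
∈-subsets⁻ (true ∷ A) D∈ | inj₂ D∈ʳ with ∈-map⁻ (true ∷_) D∈ʳ
...   | D′ , D′∈ , refl = ∷-⊆ (λ _ → refl) (∈-subsets⁻ A D′∈)

subsets-unique : ∀ {n} (A : Vertex n) → Unique (subsets A)
subsets-unique []          = [] ∷ []
subsets-unique (false ∷ A) = Unique.map⁺ ∷-injectiveʳ (subsets-unique A)
subsets-unique (true ∷ A)  = Unique.++⁺
  (Unique.map⁺ ∷-injectiveʳ (subsets-unique A)) (Unique.map⁺ ∷-injectiveʳ (subsets-unique A))
  λ (D∈ˡ , D∈ʳ) → false≢true (∈-map⁻ (false ∷_) D∈ˡ) (∈-map⁻ (true ∷_) D∈ʳ)
  where
  false≢true : ∀ {D} → ∃[ E ] (E ∈ subsets A × D ≡ false ∷ E) →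
               ∃[ E ] (E ∈ subsets A × D ≡ true ∷ E) → ⊥
  false≢true (_ , _ , refl) (_ , _ , ())

combine : ∀ {d r} → Vec (Vertex d) r → Vertex r → Vertex d
combine []      []          = 𝟎
combine (m ∷ M) (false ∷ D) = combine M D
combine (m ∷ M) (true ∷ D)  = m ⊕ combine M D

⊕-identityˡ : ∀ {n} (u : Vertex n) → 𝟎 ⊕ u ≡ u
⊕-identityˡ = zipWith-identityˡ Bool.xor-identityˡ

combine-⊕ : ∀ {d r} (M : Vec (Vertex d) r) D E → combine M (D ⊕ E) ≡ combine M D ⊕ combine M E
combine-⊕ []      []          []          = sym (⊕-self 𝟎)
combine-⊕ (m ∷ M) (false ∷ D) (false ∷ E) = combine-⊕ M D E
combine-⊕ (m ∷ M) (true ∷ D)  (false ∷ E) =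
  trans (cong (m ⊕_) (combine-⊕ M D E)) (sym (zipWith-assoc Bool.xor-assoc m _ _))
combine-⊕ (m ∷ M) (false ∷ D) (true ∷ E)  = begin
  m ⊕ combine M (D ⊕ E)               ≡⟨ cong (m ⊕_) (combine-⊕ M D E) ⟩
  m ⊕ (combine M D ⊕ combine M E)     ≡⟨ zipWith-assoc Bool.xor-assoc m _ _ ⟨
  m ⊕ combine M D ⊕ combine M E       ≡⟨ cong (_⊕ combine M E) (zipWith-comm Bool.xor-comm m _) ⟩
  combine M D ⊕ m ⊕ combine M E       ≡⟨ zipWith-assoc Bool.xor-assoc (combine M D) m _ ⟩
  combine M D ⊕ (m ⊕ combine M E)     ∎
  where open ≡-Reasoning
combine-⊕ (m ∷ M) (true ∷ D)  (true ∷ E)  = begin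
  combine M (D ⊕ E)                       ≡⟨ combine-⊕ M D E ⟩
  combine M D ⊕ combine M E               ≡⟨ ⊕-identityˡ _ ⟨
  𝟎 ⊕ (combine M D ⊕ combine M E)         ≡⟨ cong (_⊕ (combine M D ⊕ combine M E)) (⊕-self m) ⟨
  m ⊕ m ⊕ (combine M D ⊕ combine M E)     ≡⟨ ⊕-interchange m m _ _ ⟩
  m ⊕ combine M D ⊕ (m ⊕ combine M E)     ∎
  where open ≡-Reasoning

-- Independence of the truncated rows selected by `A`, tested one row at a time against the span of
-- the selected rows after it. This form lets the independent choices be counted row by row.
independent : ∀ {d r} → ℕ → Vec (Vertex d) r → Vertex r → Bool
independent k []      []          = true
independent k (m ∷ M) (false ∷ A) = independent k M A
independent k (m ∷ M) (true ∷ A)  = not (hit k (map (combine M) (subsets A)) m) ∧ independent k M A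

∧-true : ∀ a {b} → a ∧ b ≡ true → a ≡ true × b ≡ true
∧-true true eq = refl , eq

-- In a vanishing sum that uses the first row, that row equals the sum of the others and so lies in
-- their span, which the test excludes.
independent-sound : ∀ {d r} k (M : Vec (Vertex d) r) A → independent k M A ≡ true →
  ∀ D → D ⊆ A → trunc k (combine M D) ≡ 𝟎 → D ≡ 𝟎
independent-sound k []      []          ind []          D⊆A eq = refl
independent-sound k (m ∷ M) (false ∷ A) ind (false ∷ D) D⊆A eq =
  cong (false ∷_) (independent-sound k M A ind D (D⊆A ∘ suc) eq)
independent-sound k (m ∷ M) (false ∷ A) ind (true ∷ D)  D⊆A eq with () ← D⊆A zero refl
independent-sound k (m ∷ M) (true ∷ A)  ind (false ∷ D) D⊆A eq =
  cong (false ∷_) (independent-sound k M A (proj₂ (∧-true (not _) ind)) D (D⊆A ∘ suc) eq)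
independent-sound k (m ∷ M) (true ∷ A)  ind (true ∷ D)  D⊆A eq = ⊥-elim (true≢false
  (proj₁ (∧-true (not _) ind))
  (cong not (hit⁺ k (∈-map⁺ (combine M) (∈-subsets⁺ D A (D⊆A ∘ suc)))
    (sym (⊕-zero⇒≡ _ _ (trans (sym (trunc-⊕ k m (combine M D))) eq))))))

-- Only the symmetric difference has to lie in `A`; this allows sets `D` attached to different
-- vertices of a cycle to be compared inside a third vertex.
independent⇒injective : ∀ {d r} k (M : Vec (Vertex d) r) A → independent k M A ≡ true →
  ∀ D E → D ⊕ E ⊆ A → trunc k (combine M D) ≡ trunc k (combine M E) → D ≡ E
independent⇒injective k M A ind D E D⊕E⊆A eq = ⊕-zero⇒≡ D E
  (independent-sound k M A ind (D ⊕ E) D⊕E⊆A (begin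
    trunc k (combine M (D ⊕ E))                         ≡⟨ cong (trunc k) (combine-⊕ M D E) ⟩
    trunc k (combine M D ⊕ combine M E)                 ≡⟨ trunc-⊕ k _ _ ⟩
    trunc k (combine M D) ⊕ trunc k (combine M E)       ≡⟨ cong (_⊕ trunc k (combine M E)) eq ⟩
    trunc k (combine M E) ⊕ trunc k (combine M E)       ≡⟨ ⊕-self _ ⟩
    𝟎 ∎))
  where open ≡-Reasoning

-- Counting matrices with independent rows

matrices : ∀ d r → List (Vec (Vertex d) r)
matrices d zero    = [] ∷ []
matrices d (suc r) = cartesianProductWith _∷_ (allVertices d) (matrices d r)

-- The new row is summed innermost, so that its choice can be estimated with the other rows fixed.
∑-matrices : ∀ d r f → ∑ (matrices d (suc r)) f ≡
  ∑ (matrices d r) (λ M → ∑ (allVertices d) (λ m → f (m ∷ M)))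
∑-matrices d r f = trans (∑-product _∷_ (allVertices d) (matrices d r) f) (∑-swap (allVertices d) (matrices d r) _)

#matrices : ℕ → ℕ → ℕ
#matrices d r = ∑ (matrices d r) (λ _ → 1)

#matrices-suc : ∀ d r → #matrices d (suc r) ≡ 2 ^ d * #matrices d r
#matrices-suc d r = begin
  ∑ (matrices d (suc r)) (λ _ → 1)
    ≡⟨ ∑-matrices d r _ ⟩
  ∑ (matrices d r) (λ M → ∑ (allVertices d) (λ m → 1))
    ≡⟨ ∑-cong (matrices d r) (λ M → trans (∑-const (allVertices d) 1) (cong (_* 1) (allVertices-length d))) ⟩
  ∑ (matrices d r) (λ M → 2 ^ d * 1)
    ≡⟨ ∑-*ˡ (matrices d r) (2 ^ d) (λ _ → 1) ⟩
  2 ^ d * #matrices d r ∎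
  where open ≡-Reasoning

#independent : ∀ {r} → ℕ → ℕ → Vertex r → ℕ
#independent {r} d k A = ∑ (matrices d r) (λ M → 𝟙 (independent k M A))

∑-not : ∀ (xs : List X) (f : X → Bool) → ∑ xs (𝟙 ∘ not ∘ f) + ∑ xs (𝟙 ∘ f) ≡ length xs
∑-not xs f = trans (sym (∑-+ xs (𝟙 ∘ not ∘ f) (𝟙 ∘ f)))
  (trans (∑-cong xs (one ∘ f)) (trans (∑-const xs 1) (*-identityʳ _)))
  where
  one : ∀ b → 𝟙 (not b) + 𝟙 b ≡ 1
  one true  = refl
  one false = refl

-- A random vector avoids the span of j vectors with probability at least 1 - 2^(j-k).
extend-independent : ∀ {d r} l (M : Vec (Vertex d) r) A → weight A + l ≤ d →
  2 ^ d * ((2 ^ l ∸ 1) * 𝟙 (independent (weight A + l) M A)) ≤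
  2 ^ l * ∑ (allVertices d) (λ m → 𝟙 (independent (weight A + l) (m ∷ M) (true ∷ A)))
extend-independent {d} l M A k≤d with independent (weight A + l) M A
... | false = ≤-trans (≤-reflexive (trans (cong (2 ^ d *_) (*-zeroʳ (2 ^ l ∸ 1))) (*-zeroʳ (2 ^ d)))) z≤n
... | true  = *-cancelˡ-≤ (2 ^ weight A) {{m^n≢0 2 (weight A)}} (begin
  2 ^ j * (2 ^ d * ((2 ^ l ∸ 1) * 1))
    ≡⟨ solve 3 (λ a b c → a :* (b :* (c :* con 1)) := b :* (a :* c)) refl
         (2 ^ j) (2 ^ d) (2 ^ l ∸ 1) ⟩
  2 ^ d * (2 ^ j * (2 ^ l ∸ 1))
    ≡⟨ cong (2 ^ d *_) (*-distribˡ-∸ (2 ^ j) (2 ^ l) 1) ⟩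
  2 ^ d * (2 ^ j * 2 ^ l ∸ 2 ^ j * 1)
    ≡⟨ *-distribˡ-∸ (2 ^ d) (2 ^ j * 2 ^ l) (2 ^ j * 1) ⟩
  2 ^ d * (2 ^ j * 2 ^ l) ∸ 2 ^ d * (2 ^ j * 1)
    ≤⟨ m≤n+o⇒m∸n≤o _ (2 ^ d * (2 ^ j * 1)) key ⟩
  2 ^ j * (2 ^ l * N)
    ≡⟨ cong (λ t → 2 ^ j * (2 ^ l * t))
         (∑-cong V (λ m → cong 𝟙 (sym (Bool.∧-identityʳ (not (hit k L m)))))) ⟩
  2 ^ j * (2 ^ l * ∑ V (λ m → 𝟙 (not (hit k L m) ∧ true))) ∎)
  where
  open ≤-Reasoning
  j = weight A
  k = weight A + l
  V = allVertices d
  L = map (combine M) (subsets A)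
  N = ∑ V (𝟙 ∘ not ∘ hit k L)
  H = ∑ V (𝟙 ∘ hit k L)
  -- Complementary counting: `N` vectors avoid the span and `H` hit it, with `N + H` equal to
  -- `2 ^ d`. The span is listed by `2 ^ j` sums, so `∑-hit≤` bounds `H`.
  key : 2 ^ d * (2 ^ j * 2 ^ l) ≤ 2 ^ d * (2 ^ j * 1) + 2 ^ j * (2 ^ l * N)
  key = begin
    2 ^ d * (2 ^ j * 2 ^ l)
      ≡⟨ cong₂ _*_ (sym (trans (∑-not V (hit k L)) (allVertices-length d))) (sym (^-distribˡ-+-* 2 j l)) ⟩
    (N + H) * 2 ^ k
      ≡⟨ solve 3 (λ n h k → (n :+ h) :* k := k :* h :+ k :* n) refl N H (2 ^ k) ⟩
    2 ^ k * H + 2 ^ k * N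
      ≤⟨ +-mono-≤ (∑-hit≤ k k≤d L) (≤-reflexive (cong (_* N) (^-distribˡ-+-* 2 j l))) ⟩
    length L * 2 ^ d + 2 ^ j * 2 ^ l * N
      ≡⟨ cong (λ t → t * 2 ^ d + 2 ^ j * 2 ^ l * N)
           (trans (length-map (combine M) (subsets A)) (subsets-length A)) ⟩
    2 ^ j * 2 ^ d + 2 ^ j * 2 ^ l * N
      ≡⟨ solve 4 (λ j d l n → j :* d :+ j :* l :* n := d :* (j :* con 1) :+ j :* (l :* n)) refl
           (2 ^ j) (2 ^ d) (2 ^ l) N ⟩
    2 ^ d * (2 ^ j * 1) + 2 ^ j * (2 ^ l * N) ∎

-- The successive factors 1 - 2^(-m) for m from l+1 to k multiply to P_k / P_l, here
-- cross-multiplied. The slack `l` counts the vectors missing from a basis, so `k` stays fixed while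
-- the induction shortens `A`.
#independent≥ : ∀ {r} d k l (A : Vertex r) → weight A + l ≡ k → k ≤ d →
  numP k * denP l * #matrices d r ≤ denP k * numP l * #independent d k A
#independent≥ d k l [] refl k≤d = ≤-reflexive (cong (_* 1) (*-comm (numP l) (denP l)))
#independent≥ {suc r} d k l (false ∷ A) eq k≤d = begin
  numP k * denP l * #matrices d (suc r)
    ≡⟨ cong (numP k * denP l *_) (#matrices-suc d r) ⟩
  numP k * denP l * (2 ^ d * #matrices d r)
    ≡⟨ solve 4 (λ a b c m → a :* b :* (c :* m) := c :* (a :* b :* m)) refl
         (numP k) (denP l) (2 ^ d) (#matrices d r) ⟩
  2 ^ d * (numP k * denP l * #matrices d r)
    ≤⟨ *-monoʳ-≤ (2 ^ d) (#independent≥ d k l A eq k≤d) ⟩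
  2 ^ d * (denP k * numP l * #independent d k A)
    ≡⟨ solve 4 (λ a b c m → c :* (a :* b :* m) := a :* b :* (c :* m)) refl
         (denP k) (numP l) (2 ^ d) (#independent d k A) ⟩
  denP k * numP l * (2 ^ d * #independent d k A)
    ≡⟨ cong (denP k * numP l *_) (begin-equality
      2 ^ d * #independent d k A
        ≡⟨ ∑-*ˡ (matrices d r) (2 ^ d) _ ⟨
      ∑ (matrices d r) (λ M → 2 ^ d * 𝟙 (independent k M A))
        ≡⟨ ∑-cong (matrices d r) (λ M → trans (∑-const (allVertices d) _)
             (cong (_* 𝟙 (independent k M A)) (allVertices-length d))) ⟨
      ∑ (matrices d r) (λ M → ∑ (allVertices d) (λ m → 𝟙 (independent k M A)))
        ≡⟨ ∑-matrices d r _ ⟨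
      #independent d k (false ∷ A) ∎) ⟩
  denP k * numP l * #independent d k (false ∷ A) ∎
  where open ≤-Reasoning
#independent≥ {suc r} d k l (true ∷ A) eq k≤d with trans (+-suc (weight A) l) eq
... | refl = *-cancelˡ-≤ (2 ^ suc l) {{m^n≢0 2 (suc l)}} (begin
  2 ^ suc l * (numP k * denP l * #matrices d (suc r))
    ≡⟨ cong (λ t → 2 ^ suc l * (numP k * denP l * t)) (#matrices-suc d r) ⟩
  2 ^ suc l * (numP k * denP l * (2 ^ d * #matrices d r))
    ≡⟨ solve 5 (λ t a b c m → t :* (a :* b :* (c :* m)) := c :* (a :* (b :* t) :* m)) refl
         (2 ^ suc l) (numP k) (denP l) (2 ^ d) (#matrices d r) ⟩
  2 ^ d * (numP k * denP (suc l) * #matrices d r)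
    ≤⟨ *-monoʳ-≤ (2 ^ d) (#independent≥ d k (suc l) A refl k≤d) ⟩
  2 ^ d * (denP k * numP (suc l) * #independent d k A)
    ≡⟨ solve 5 (λ a b c d m → d :* (a :* (b :* c) :* m) := a :* b :* (d :* c :* m)) refl
         (denP k) (numP l) (2 ^ suc l ∸ 1) (2 ^ d) (#independent d k A) ⟩
  denP k * numP l * (2 ^ d * (2 ^ suc l ∸ 1) * #independent d k A)
    ≤⟨ *-monoʳ-≤ (denP k * numP l) (begin
      2 ^ d * (2 ^ suc l ∸ 1) * #independent d k A
        ≡⟨ ∑-*ˡ (matrices d r) (2 ^ d * (2 ^ suc l ∸ 1)) _ ⟨
      ∑ (matrices d r) (λ M → 2 ^ d * (2 ^ suc l ∸ 1) * 𝟙 (independent k M A))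
        ≤⟨ ∑-mono (matrices d r) (λ M → ≤-trans (≤-reflexive (*-assoc (2 ^ d) _ _))
             (extend-independent (suc l) M A k≤d)) ⟩
      ∑ (matrices d r) (λ M → 2 ^ suc l * ∑ (allVertices d) (λ m → 𝟙 (independent k (m ∷ M) (true ∷ A))))
        ≡⟨ ∑-*ˡ (matrices d r) (2 ^ suc l) _ ⟩
      2 ^ suc l * ∑ (matrices d r) (λ M → ∑ (allVertices d) (λ m → 𝟙 (independent k (m ∷ M) (true ∷ A))))
        ≡⟨ cong (2 ^ suc l *_) (∑-matrices d r _) ⟨
      2 ^ suc l * #independent d k (true ∷ A) ∎) ⟩
  denP k * numP l * (2 ^ suc l * #independent d k (true ∷ A))
    ≡⟨ solve 4 (λ a b t m → a :* b :* (t :* m) := t :* (a :* b :* m)) refl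
         (denP k) (numP l) (2 ^ suc l) (#independent d k (true ∷ A)) ⟩
  2 ^ suc l * (denP k * numP l * #independent d k (true ∷ A)) ∎)
  where open ≤-Reasoning

P-antitone : ∀ k t → numP (t + k) * denP k ≤ numP k * denP (t + k)
P-antitone k zero    = ≤-refl
P-antitone k (suc t) = begin
  numP (t + k) * (2 ^ suc (t + k) ∸ 1) * denP k
    ≤⟨ *-monoˡ-≤ (denP k) (*-monoʳ-≤ (numP (t + k)) (m∸n≤m (2 ^ suc (t + k)) 1)) ⟩
  numP (t + k) * 2 ^ suc (t + k) * denP k
    ≡⟨ solve 3 (λ a b c → a :* b :* c := a :* c :* b) refl
         (numP (t + k)) (2 ^ suc (t + k)) (denP k) ⟩
  numP (t + k) * denP k * 2 ^ suc (t + k)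
    ≤⟨ *-monoˡ-≤ (2 ^ suc (t + k)) (P-antitone k t) ⟩
  numP k * denP (t + k) * 2 ^ suc (t + k)
    ≡⟨ *-assoc (numP k) _ _ ⟩
  numP k * denP (suc t + k) ∎
  where open ≤-Reasoning

numP>0 : ∀ k → 0 < numP k
numP>0 zero    = s≤s z≤n
numP>0 (suc k) = *-mono-< (numP>0 k)
  (m<n⇒0<n∸m (+-mono-≤ (m^n>0 2 k) (≤-trans (m^n>0 2 k) (m≤m+n (2 ^ k) 0))))

denP≢0 : ∀ k → NonZero (denP k)
denP≢0 zero    = _
denP≢0 (suc k) = m*n≢0 (denP k) (2 ^ suc k) {{denP≢0 k}} {{m^n≢0 2 (suc k)}}

-- The random subgraph and the probability that an edge is kept

parity : ∀ {n} → Vertex n → Bool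
parity []      = false
parity (a ∷ v) = a xor parity v

sumsThrough : ∀ {n} → Vec (Vertex n) n → Vertex n → Fin n → List (Vertex n)
sumsThrough M v i = map (λ D → combine M (D [ i ]≔ true)) (subsets v)

linked : ∀ {n} → Vec (Vertex n) n → Vertex n → Vertex n → Fin n → Bool
linked M w v i =
  independent (weight (v [ i ]≔ true)) M (v [ i ]≔ true) ∧ hit (weight (v [ i ]≔ true)) (sumsThrough M v i) w

-- The first Boolean prescribes the left parity of an edge, the second the parity of its lower
-- endpoint.
Ω : ℕ → Set
Ω n = Vec (Vertex n) n × Vertex n × Bool × Bool

keep : ∀ {n} → Ω n → Subgraph n
keep (M , w , p , q) v i =
  does (parity v Bool.≟ q) ∧ (does (leftParity v i Bool.≟ p) ∧ linked M w v i)

outcomes : ∀ n → List (Ω n)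
outcomes n = cartesianProductWith _,_ (matrices n n) (cartesianProductWith _,_ (allVertices n)
  (cartesianProductWith _,_ bools bools))
  where bools = false ∷ true ∷ []

∑-outcomes : ∀ n (f : Ω n → ℕ) → ∑ (outcomes n) f ≡
  ∑ (matrices n n) (λ M → ∑ (allVertices n) (λ w →
    f (M , w , false , false) + (f (M , w , false , true) + (f (M , w , true , false) + (f (M , w , true , true) + 0)))))
∑-outcomes n f = trans (∑-product _,_ (matrices n n) _ f)
  (∑-cong (matrices n n) (λ M → ∑-product _,_ (allVertices n) _ _))

outcomes-length : ∀ n → length (outcomes n) ≡ 4 * (#matrices n n * 2 ^ n)
outcomes-length n = begin
  length (outcomes n)
    ≡⟨ trans (∑-const (outcomes n) 1) (*-identityʳ _) ⟨
  ∑ (outcomes n) (λ _ → 1)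
    ≡⟨ ∑-outcomes n (λ _ → 1) ⟩
  ∑ (matrices n n) (λ M → ∑ (allVertices n) (λ w → 4))
    ≡⟨ ∑-cong (matrices n n) (λ M → trans (∑-const (allVertices n) 4)
         (trans (cong (_* 4) (allVertices-length n)) (sym (*-identityʳ _)))) ⟩
  ∑ (matrices n n) (λ M → 2 ^ n * 4 * 1)
    ≡⟨ ∑-*ˡ (matrices n n) (2 ^ n * 4) (λ _ → 1) ⟩
  2 ^ n * 4 * #matrices n n
    ≡⟨ solve 2 (λ a b → a :* con 4 :* b := con 4 :* (b :* a)) refl (2 ^ n) (#matrices n n) ⟩
  4 * (#matrices n n * 2 ^ n) ∎
  where open ≡-Reasoning

weight-add : ∀ {n} (v : Vertex n) i → lookup v i ≡ false → weight (v [ i ]≔ true) ≡ suc (weight v)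
weight-add (false ∷ v) zero    _  = refl
weight-add (true ∷ v)  (suc i) eq = cong suc (weight-add v i eq)
weight-add (false ∷ v) (suc i) eq = weight-add v i eq

add-⊆ : ∀ {n} (D A : Vertex n) i → D ⊆ A → (D [ i ]≔ true) ⊆ (A [ i ]≔ true)
add-⊆ D A i D⊆A j j∈D with j ≟ i
... | yes refl = lookup∘updateAt i A
... | no j≢i   = trans (lookup∘updateAt′ j i j≢i A) (D⊆A j (trans (sym (lookup∘updateAt′ j i j≢i D)) j∈D))

⊕-⊆ : ∀ {n} (D E A : Vertex n) → D ⊆ A → E ⊆ A → D ⊕ E ⊆ A
⊕-⊆ D E A D⊆A E⊆A i i∈ with lookup D i in eqD | lookup E i in eqE
... | true  | _     = D⊆A i eqD
... | false | true  = E⊆A i eqE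
... | false | false = ⊥-elim (true≢false i∈ (trans (lookup-zipWith _xor_ i D E) (cong₂ _xor_ eqD eqE)))

add-cancel : ∀ {n} {D E : Vertex n} i → lookup D i ≡ false → lookup E i ≡ false →
  D [ i ]≔ true ≡ E [ i ]≔ true → D ≡ E
add-cancel {D = D} {E} i i∉D i∉E eq = trans (sym (restore D i∉D)) (trans (cong (_[ i ]≔ false) eq) (restore E i∉E))
  where
  restore : ∀ F → lookup F i ≡ false → (F [ i ]≔ true) [ i ]≔ false ≡ F
  restore F i∉F = trans ([]≔-idempotent F i) (trans (cong (F [ i ]≔_) (sym i∉F)) ([]≔-lookup F i))

-- Membership is handed to the hypothesis because adjoining `i` is injective only on sets that avoid
-- `i`, and this is known for members of `subsets v`.
AllPairs-map-∈ : ∀ {R : Y → Y → Set} (f : X → Y) {xs : List X} → Unique xs →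
  (∀ {x y} → x ∈ xs → y ∈ xs → x ≢ y → R (f x) (f y)) → AllPairs R (map f xs)
AllPairs-map-∈ f []        r = []
AllPairs-map-∈ f {x ∷ xs} (x≢ ∷ u) r =
  all-map x≢ (λ y∈ x≢y → r (here refl) (there y∈) x≢y) ∷
  AllPairs-map-∈ f u (λ x∈ y∈ → r (there x∈) (there y∈))
  where
  all-map : ∀ {ys} {P} → All (x ≢_) ys → (∀ {y} → y ∈ ys → x ≢ y → P (f y)) → All P (map f ys)
  all-map []         h = []
  all-map (x≢y ∷ ps) h = h (here refl) x≢y ∷ all-map ps (h ∘ there)

-- By independence the `2 ^ weight v` sums of subsets of B through `i` have distinct truncations.
-- They fill half of the space of k-bit vectors, where k is `weight v` plus one, so at least half of
-- all `w` are hit.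
∑-linked : ∀ {n} (M : Vec (Vertex n) n) v i → lookup v i ≡ false →
  2 ^ n * 𝟙 (independent (weight (v [ i ]≔ true)) M (v [ i ]≔ true)) ≤
  2 * ∑ (allVertices n) (λ w → 𝟙 (linked M w v i))
∑-linked {n} M v i i∉v with independent (weight (v [ i ]≔ true)) M (v [ i ]≔ true) in ind
... | false = ≤-trans (≤-reflexive (*-zeroʳ (2 ^ n))) z≤n
... | true  = *-cancelˡ-≤ (2 ^ weight v) {{m^n≢0 2 (weight v)}} (begin
  2 ^ weight v * (2 ^ n * 1)
    ≡⟨ cong₂ _*_ (sym (trans (length-map _ (subsets v)) (subsets-length v))) (*-identityʳ (2 ^ n)) ⟩
  length (sumsThrough M v i) * 2 ^ n
    ≤⟨ ∑-hit≥ k (weight≤ B) (sumsThrough M v i) distinct ⟩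
  2 ^ k * H
    ≡⟨ cong (λ t → 2 ^ t * H) (weight-add v i i∉v) ⟩
  2 * 2 ^ weight v * H
    ≡⟨ solve 2 (λ a h → con 2 :* a :* h := a :* (con 2 :* h)) refl (2 ^ weight v) H ⟩
  2 ^ weight v * (2 * H) ∎)
  where
  open ≤-Reasoning
  B = v [ i ]≔ true
  k = weight B
  H = ∑ (allVertices n) (𝟙 ∘ hit k (sumsThrough M v i))
  distinct : AllPairs (λ z z′ → trunc k z ≢ trunc k z′) (sumsThrough M v i)
  distinct = AllPairs-map-∈ _ (subsets-unique v) λ {D} {E} D∈ E∈ D≢E eq →
    let D⊆v = ∈-subsets⁻ v D∈
        E⊆v = ∈-subsets⁻ v E∈
    in D≢E (add-cancel i (∉-⊆ D v i D⊆v i∉v) (∉-⊆ E v i E⊆v i∉v)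
         (independent⇒injective k M B ind (D [ i ]≔ true) (E [ i ]≔ true)
           (⊕-⊆ (D [ i ]≔ true) (E [ i ]≔ true) B (add-⊆ D v i D⊆v) (add-⊆ E v i E⊆v)) eq))

-- Every edge is kept with probability at least P_n / 8: a factor P_k, at least P_n, for the basis,
-- 1/2 for `w`, and 1/4 for the two prescribed parities.
∑-keep : ∀ {n} (v : Vertex n) i → lookup v i ≡ false →
  numP n * (#matrices n n * 2 ^ n) ≤ 2 * denP n * ∑ (outcomes n) (λ ω → 𝟙 (keep ω v i))
∑-keep {n} v i i∉v = *-cancelˡ-≤ (denP k) {{denP≢0 k}} (begin
  denP k * (numP n * (N * 2 ^ n))
    ≡⟨ solve 4 (λ a b c d → a :* (b :* (c :* d)) := b :* a :* (c :* d)) refl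
         (denP k) (numP n) N (2 ^ n) ⟩
  numP n * denP k * (N * 2 ^ n)
    ≤⟨ *-monoˡ-≤ (N * 2 ^ n) (subst (λ n → numP n * denP k ≤ numP k * denP n)
         (m∸n+n≡m (weight≤ B)) (P-antitone k (n ∸ k))) ⟩
  numP k * denP n * (N * 2 ^ n)
    ≡⟨ solve 4 (λ a b c d → a :* b :* (c :* d) := b :* d :* (a :* con 1 :* c)) refl
         (numP k) (denP n) N (2 ^ n) ⟩
  denP n * 2 ^ n * (numP k * 1 * N)
    -- Slack 0: the truncation length is the size of `B`, so the independent vectors form a basis.
    ≤⟨ *-monoʳ-≤ (denP n * 2 ^ n) (#independent≥ n k 0 B (+-identityʳ k) (weight≤ B)) ⟩
  denP n * 2 ^ n * (denP k * 1 * #independent n k B)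
    ≡⟨ solve 4 (λ a b c d → a :* b :* (c :* con 1 :* d) := c :* a :* (b :* d)) refl
         (denP n) (2 ^ n) (denP k) (#independent n k B) ⟩
  denP k * denP n * (2 ^ n * #independent n k B)
    ≤⟨ *-monoʳ-≤ (denP k * denP n) (begin
      2 ^ n * #independent n k B
        ≡⟨ ∑-*ˡ (matrices n n) (2 ^ n) _ ⟨
      ∑ (matrices n n) (λ M → 2 ^ n * 𝟙 (independent k M B))
        ≤⟨ ∑-mono (matrices n n) (λ M → ∑-linked M v i i∉v) ⟩
      ∑ (matrices n n) (λ M → 2 * ∑ (allVertices n) (λ w → 𝟙 (linked M w v i)))
        ≡⟨ ∑-*ˡ (matrices n n) 2 _ ⟩
      2 * ∑ (matrices n n) (λ M → ∑ (allVertices n) (λ w → 𝟙 (linked M w v i)))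
        ≡⟨ cong (2 *_) (trans (∑-outcomes n _) (∑-cong (matrices n n) λ M → ∑-cong (allVertices n) λ w →
             one-colour (parity v) (leftParity v i) (linked M w v i))) ⟨
      2 * ∑ (outcomes n) (λ ω → 𝟙 (keep ω v i)) ∎) ⟩
  denP k * denP n * (2 * ∑ (outcomes n) (λ ω → 𝟙 (keep ω v i)))
    ≡⟨ solve 3 (λ a b c → a :* b :* (con 2 :* c) := a :* (con 2 :* b :* c)) refl
         (denP k) (denP n) _ ⟩
  denP k * (2 * denP n * ∑ (outcomes n) (λ ω → 𝟙 (keep ω v i))) ∎)
  where
  open ≤-Reasoning
  B = v [ i ]≔ true
  k = weight B
  N = #matrices n n
  one-colour : ∀ a b c → let f = λ p q → 𝟙 (does (a Bool.≟ q) ∧ (does (b Bool.≟ p) ∧ c)) in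
    f false false + (f false true + (f true false + (f true true + 0))) ≡ 𝟙 c
  one-colour false false c = +-identityʳ (𝟙 c)
  one-colour false true  c = +-identityʳ (𝟙 c)
  one-colour true  false c = +-identityʳ (𝟙 c)
  one-colour true  true  c = +-identityʳ (𝟙 c)

-- Expected number of edges and a dense outcome

edgeSum : ∀ {n} → (Vertex n → Fin n → ℕ) → ℕ
edgeSum {n} f = ∑ (allVertices n) (λ v → ∑ (allFin n) (λ i → if lookup v i then 0 else f v i))

edgeCount≡ : ∀ {n} (S : Subgraph n) → edgeCount S ≡ edgeSum (λ v i → 𝟙 (S v i))
edgeCount≡ {n} S = ∑-concatMap (allVertices n)
  where
  row : Vertex n → List ℕ
  row v = map (λ i → if lookup v i then 0 else 𝟙 (S v i)) (allFin n)
  ∑-concatMap : ∀ vs → sum (concatMap row vs) ≡ ∑ vs (sum ∘ row)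
  ∑-concatMap []       = refl
  ∑-concatMap (v ∷ vs) = trans (sum-++ (row v) _) (cong (sum (row v) +_) (∑-concatMap vs))

edgeSum-mono : ∀ {n} {f g : Vertex n → Fin n → ℕ} →
  (∀ v i → lookup v i ≡ false → f v i ≤ g v i) → edgeSum f ≤ edgeSum g
edgeSum-mono {n} {f} {g} le = ∑-mono (allVertices n) λ v → ∑-mono (allFin n) λ i → local v i
  where
  local : ∀ v i → (if lookup v i then 0 else f v i) ≤ (if lookup v i then 0 else g v i)
  local v i with lookup v i in eq
  ... | true  = z≤n
  ... | false = le v i eq

edgeSum-*ˡ : ∀ {n} c (f : Vertex n → Fin n → ℕ) → edgeSum (λ v i → c * f v i) ≡ c * edgeSum f
edgeSum-*ˡ {n} c f = trans
  (∑-cong (allVertices n) λ v → trans (∑-cong (allFin n) (λ i → local (lookup v i) (f v i))) (∑-*ˡ (allFin n) c _))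
  (∑-*ˡ (allVertices n) c _)
  where
  local : ∀ b m → (if b then 0 else c * m) ≡ c * (if b then 0 else m)
  local true  m = sym (*-zeroʳ c)
  local false m = refl

edgeSum-∑ : ∀ {n} (xs : List X) (f : X → Vertex n → Fin n → ℕ) →
  ∑ xs (λ x → edgeSum (f x)) ≡ edgeSum (λ v i → ∑ xs (λ x → f x v i))
edgeSum-∑ {n = n} xs f = trans (∑-swap xs (allVertices n) _)
  (∑-cong (allVertices n) λ v → trans (∑-swap xs (allFin n) _)
    (∑-cong (allFin n) λ i → local (lookup v i) (λ x → f x v i)))
  where
  local : ∀ b g → ∑ xs (λ x → if b then 0 else g x) ≡ (if b then 0 else ∑ xs g)
  local true  g = trans (∑-const xs 0) (*-zeroʳ (length xs))
  local false g = refl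

∑-edgeCount-keep : ∀ n → numP n * (#matrices n n * 2 ^ n) * eQ n ≤
  2 * denP n * ∑ (outcomes n) (λ ω → edgeCount (keep ω))
∑-edgeCount-keep n = begin
  c * eQ n
    ≡⟨ cong (c *_) (edgeCount≡ (fullQ n)) ⟩
  c * edgeSum {n} (λ _ _ → 1)
    ≡⟨ edgeSum-*ˡ {n} c (λ _ _ → 1) ⟨
  edgeSum {n} (λ _ _ → c * 1)
    ≤⟨ edgeSum-mono {n} (λ v i i∉v → ≤-trans (≤-reflexive (*-identityʳ c)) (∑-keep v i i∉v)) ⟩
  edgeSum {n} (λ v i → 2 * denP n * ∑ (outcomes n) (λ ω → 𝟙 (keep ω v i)))
    ≡⟨ edgeSum-*ˡ {n} (2 * denP n) (λ v i → ∑ (outcomes n) (λ ω → 𝟙 (keep ω v i))) ⟩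
  2 * denP n * edgeSum {n} (λ v i → ∑ (outcomes n) (λ ω → 𝟙 (keep ω v i)))
    ≡⟨ cong (2 * denP n *_) (trans (∑-cong (outcomes n) (λ ω → edgeCount≡ (keep ω)))
         (edgeSum-∑ (outcomes n) (λ ω v i → 𝟙 (keep ω v i)))) ⟨
  2 * denP n * ∑ (outcomes n) (λ ω → edgeCount (keep ω)) ∎
  where
  open ≤-Reasoning
  c = numP n * (#matrices n n * 2 ^ n)

∑-∈ : ∀ {xs : List X} {x} (f : X → ℕ) → x ∈ xs → f x ≤ ∑ xs f
∑-∈ f (here refl)  = m≤m+n (f _) _
∑-∈ f (there x∈xs) = ≤-trans (∑-∈ f x∈xs) (m≤n+m _ (f _))

𝟎∈allVertices : ∀ n → 𝟎 ∈ allVertices n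
𝟎∈allVertices zero    = here refl
𝟎∈allVertices (suc n) = ∈-++⁺ˡ (∈-map⁺ (false ∷_) (𝟎∈allVertices n))

eQ>0 : ∀ n → 0 < eQ (suc n)
eQ>0 n = subst (0 <_) (sym (edgeCount≡ (fullQ (suc n))))
  (≤-trans (∑-∈ {xs = allFin (suc n)} (λ i → if lookup (𝟎 {suc n}) i then 0 else 1) (here refl))
    (∑-∈ (λ v → ∑ (allFin (suc n)) (λ i → if lookup v i then 0 else 1)) (𝟎∈allVertices (suc n))))

#matrices>0 : ∀ d r → 0 < #matrices d r
#matrices>0 d zero    = s≤s z≤n
#matrices>0 d (suc r) = subst (0 <_) (sym (#matrices-suc d r)) (*-mono-< (m^n>0 2 d) (#matrices>0 d r))

dense-outcome : ∀ n → 1 ≤ n → ∃[ ω ] eQ n * numP n < 12 * edgeCount (keep {n} ω) * denP n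
dense-outcome (suc m) _ = ∑-above-average (outcomes n) _ (eQ n * numP n) (begin-strict
  length (outcomes n) * (eQ n * numP n)
    ≡⟨ cong (_* (eQ n * numP n)) (outcomes-length n) ⟩
  4 * (N * 2 ^ n) * (eQ n * numP n)
    ≡⟨ solve 4 (λ a b e p → con 4 :* (a :* b) :* (e :* p) := con 4 :* (p :* (a :* b) :* e)) refl
         N (2 ^ n) (eQ n) (numP n) ⟩
  4 * E
    -- The 4 counts the choices of the two parities, and the 6 is 12 divided by the 2 in
    -- `∑-edgeCount-keep`. The gap between 1/8 and 1/12 gives strictness, as soon as there is an
    -- edge at all.
    <⟨ *-monoˡ-< E {{>-nonZero E>0}} {4} {6} (s≤s (s≤s (s≤s (s≤s (s≤s z≤n))))) ⟩
  6 * E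
    ≤⟨ *-monoʳ-≤ 6 (∑-edgeCount-keep n) ⟩
  6 * (2 * denP n * ∑ (outcomes n) (λ ω → edgeCount (keep ω)))
    ≡⟨ solve 2 (λ d t → con 6 :* (con 2 :* d :* t) := con 12 :* d :* t) refl (denP n) _ ⟩
  12 * denP n * ∑ (outcomes n) (λ ω → edgeCount (keep ω))
    ≡⟨ ∑-*ˡ (outcomes n) (12 * denP n) _ ⟨
  ∑ (outcomes n) (λ ω → 12 * denP n * edgeCount (keep ω))
    ≡⟨ ∑-cong (outcomes n) (λ ω →
         solve 2 (λ d e → con 12 :* d :* e := con 12 :* e :* d) refl (denP n) (edgeCount (keep ω))) ⟩
  ∑ (outcomes n) (λ ω → 12 * edgeCount (keep ω) * denP n) ∎)
  where
  open ≤-Reasoning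
  n = suc m
  N = #matrices n n
  E = numP n * (N * 2 ^ n) * eQ n
  E>0 : 0 < E
  E>0 = *-mono-< (*-mono-< (numP>0 n) (*-mono-< (#matrices>0 n n) (m^n>0 2 n))) (eQ>0 m)

-- Kept 10-cycles as swap cycles

does-true : (a? : Dec X) → does a? ≡ true → X
does-true (yes a) refl = a

parity-flip : ∀ {n} (v : Vertex n) i → parity (flip v i) ≡ not (parity v)
parity-flip (a ∷ v) zero    = sym (Bool.not-distribˡ-xor a (parity v))
parity-flip (a ∷ v) (suc i) =
  trans (cong (a xor_) (parity-flip v i)) (sym (Bool.not-distribʳ-xor a (parity v)))

flip-∉ : ∀ {n} (v : Vertex n) i → lookup v i ≡ false → flip v i ≡ v [ i ]≔ true
flip-∉ v i i∉v = cong (λ b → v [ i ]≔ not b) i∉v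

flip-∈ : ∀ {n} (v : Vertex n) i → lookup v i ≡ true → flip v i ≡ v [ i ]≔ false
flip-∈ v i i∈v = cong (λ b → v [ i ]≔ not b) i∈v

set-same : ∀ {n} (v : Vertex n) i {b} → lookup v i ≡ b → v [ i ]≔ b ≡ v
set-same v i refl = []≔-lookup v i

weight-flip : ∀ {n} (v : Vertex n) i → lookup v i ≡ false → weight (flip v i) ≡ suc (weight v)
weight-flip v i i∉v = trans (cong weight (flip-∉ v i i∉v)) (weight-add v i i∉v)

next10²≢ : ∀ j → j ≢ next10 (next10 j)
next10²≢ 0F ()
next10²≢ 1F ()
next10²≢ 2F ()
next10²≢ 3F ()
next10²≢ 4F ()
next10²≢ 5F ()
next10²≢ 6F ()
next10²≢ 7F ()
next10²≢ 8F ()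
next10²≢ 9F ()

double : Fin 5 → Fin 10
double 0F = 0F
double 1F = 2F
double 2F = 4F
double 3F = 6F
double 4F = 8F

double-nxt : ∀ j → next10 (next10 (double j)) ≡ double (nxt j)
double-nxt 0F = refl
double-nxt 1F = refl
double-nxt 2F = refl
double-nxt 3F = refl
double-nxt 4F = refl

nxt-orbit : ∀ (P : Fin 5 → Set) → P 0F → (∀ j → P j → P (nxt j)) → ∀ j → P j
nxt-orbit P p₀ s 0F = p₀
nxt-orbit P p₀ s 1F = s 0F p₀
nxt-orbit P p₀ s 2F = s 1F (s 0F p₀)
nxt-orbit P p₀ s 3F = s 2F (s 1F (s 0F p₀))
nxt-orbit P p₀ s 4F = s 3F (s 2F (s 1F (s 0F p₀)))

module _ {n} (M : Vec (Vertex n) n) (w : Vertex n) (p q : Bool) where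

  S : Subgraph n
  S = keep (M , w , p , q)

  -- Everything is expressed through the upper endpoint, which the two cycle edges meeting at an
  -- upper vertex share.
  record Kept (B : Vertex n) (i : Fin n) : Set where
    field
      left  : leftParity B i ≡ p
      indep : independent (weight B) M B ≡ true
      D     : Vertex n
      i∈D   : lookup D i ≡ true
      D⊆B   : D ⊆ B
      sum-D : trunc (weight B) (combine M D) ≡ trunc (weight B) w

  keep-kept : ∀ v i → S v i ≡ true → parity v ≡ q × Kept (v [ i ]≔ true) i
  keep-kept v i kept with ∧-true (does (parity v Bool.≟ q)) kept
  ... | par , kept₁ with ∧-true (does (leftParity v i Bool.≟ p)) kept₁
  ... | left , kept₂ with ∧-true (independent (weight (v [ i ]≔ true)) M (v [ i ]≔ true)) kept₂
  ... | ind , h with hit⁻ (weight (v [ i ]≔ true)) (sumsThrough M v i) h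
  ... | z , z∈ , eq with ∈-map⁻ (λ D → combine M (D [ i ]≔ true)) z∈
  ... | D , D∈ , refl = does-true (parity v Bool.≟ q) par , record
    { left  = trans (leftParity-update v i true) (does-true (leftParity v i Bool.≟ p) left)
    ; indep = ind
    ; D     = D [ i ]≔ true
    ; i∈D   = lookup∘updateAt i D
    ; D⊆B   = add-⊆ D v i (∈-subsets⁻ v D∈)
    ; sum-D = eq
    }

  -- The lower endpoint of a kept edge has parity `q` and the upper one the opposite parity, so the
  -- parity of an endpoint tells which of the two it is.
  edge-up : ∀ {u i} → parity u ≡ q → S (u [ i ]≔ false) i ≡ true →
    lookup u i ≡ false × Kept (flip u i) i
  edge-up {u} {i} par kept with lookup u i in eq
  ... | false = refl , subst (λ B → Kept B i) ([]≔-idempotent u i) (proj₂ (keep-kept (u [ i ]≔ false) i kept))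
  ... | true  = ⊥-elim (Bool.not-¬ {q} refl (trans (sym (proj₁ (keep-kept (u [ i ]≔ false) i kept)))
    (trans (cong parity (sym (flip-∈ u i eq))) (trans (parity-flip u i) (cong not par)))))

  edge-down : ∀ {u i} → parity u ≡ not q → S (u [ i ]≔ false) i ≡ true →
    lookup u i ≡ true × Kept u i
  edge-down {u} {i} par kept with lookup u i in eq
  ... | true  = refl , subst (λ B → Kept B i) (trans ([]≔-idempotent u i) (set-same u i eq))
                         (proj₂ (keep-kept (u [ i ]≔ false) i kept))
  ... | false = ⊥-elim (Bool.not-¬ {q} refl (trans (sym (proj₁ (keep-kept (u [ i ]≔ false) i kept)))
    (trans (cong parity (set-same u i eq)) par)))

  module _ (c : Fin 10 → Vertex n) (c≢c² : ∀ j → c j ≢ c (next10 (next10 j)))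
           (adj : ∀ j → Adj S (c j) (c (next10 j))) (top : parity (c 0F) ≡ not q) where

    private
      B : Fin 5 → Vertex n
      B j = c (double j)

      dir : Fin 10 → Fin n
      dir j = proj₁ (adj j)

      c-next : ∀ j → c (next10 j) ≡ flip (c j) (dir j)
      c-next j = proj₁ (proj₂ (adj j))

      -- Flipping the same coordinate twice would return to `c j` after two steps.
      dir≢ : ∀ j → dir j ≢ dir (next10 j)
      dir≢ j eq = c≢c² j (sym (trans (c-next (next10 j))
        (trans (cong₂ flip (c-next j) (sym eq)) (flip-flip (c j) (dir j)))))

      x y : Fin 5 → Fin n
      x j = dir (double j)
      y j = dir (next10 (double j))

      A : Fin 5 → Vertex n
      A j = c (next10 (double j))

      A≡ : ∀ j → A j ≡ flip (B j) (x j)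
      A≡ j = c-next (double j)

      B≡ : ∀ j → B (nxt j) ≡ flip (A j) (y j)
      B≡ j = trans (cong c (sym (double-nxt j))) (c-next (next10 (double j)))

      parity-A : ∀ j → parity (B j) ≡ not q → parity (A j) ≡ q
      parity-A j par = trans (cong parity (A≡ j))
        (trans (parity-flip (B j) (x j)) (trans (cong not par) (Bool.not-involutive q)))

      parity-B : ∀ j → parity (B j) ≡ not q
      parity-B = nxt-orbit _ top λ j par → trans (cong parity (B≡ j))
        (trans (parity-flip (A j) (y j)) (cong not (parity-A j par)))

      down : ∀ j → lookup (B j) (x j) ≡ true × Kept (B j) (x j)
      down j = edge-down (parity-B j) (proj₂ (proj₂ (adj (double j))))

      up : ∀ j → lookup (A j) (y j) ≡ false × Kept (B (nxt j)) (y j)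
      up j with edge-up (parity-A j (parity-B j)) (proj₂ (proj₂ (adj (next10 (double j)))))
      ... | y∉A , kept = y∉A , subst (λ B → Kept B (y j)) (sym (B≡ j)) kept

      weight-A : ∀ j → weight (B j) ≡ suc (weight (A j))
      weight-A j = trans (cong weight B≡flipA) (weight-flip (A j) (x j)
        (trans (cong (λ v → lookup v (x j)) (A≡ j)) (trans (lookup-flip (B j) (x j)) (cong not (proj₁ (down j))))))
        where
        B≡flipA : B j ≡ flip (A j) (x j)
        B≡flipA = trans (sym (flip-flip (B j) (x j))) (cong (λ v → flip v (x j)) (sym (A≡ j)))

      -- All upper vertices have the same size, so the sums of all the sets `D` around the cycle are
      -- compared with `w` at one common truncation length.
      weight-B : ∀ j → weight (B j) ≡ weight (B 0F)
      weight-B = nxt-orbit _ refl λ j eq → trans (cong weight (B≡ j))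
        (trans (weight-flip (A j) (y j) (proj₁ (up j))) (trans (sym (weight-A j)) eq))

      open Kept

      sum-D₀ : ∀ j {i} (κ : Kept (B j) i) → trunc (weight (B 0F)) (combine M (D κ)) ≡ trunc (weight (B 0F)) w
      sum-D₀ j κ = subst (λ k → trunc k (combine M (D κ)) ≡ trunc k w) (weight-B j) (sum-D κ)

      D-unique : ∀ j k l {i i′} (κ : Kept (B j) i) (κ′ : Kept (B k) i′) →
        D κ ⊕ D κ′ ⊆ B l → D κ ≡ D κ′
      D-unique j k l κ κ′ sub = independent⇒injective (weight (B 0F)) M (B l)
        (subst (λ k → independent k M (B l) ≡ true) (weight-B l) (indep (proj₂ (down l))))
        (D κ) (D κ′) sub (trans (sum-D₀ j κ) (sym (sum-D₀ k κ′)))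

      Dₓ : Fin 5 → Vertex n
      Dₓ j = D (proj₂ (down j))

    toSwapCycle : SwapCycle n
    toSwapCycle = record
      { B = B
      ; D = Dₓ
      ; x = x
      ; y = y
      ; p = p
      ; step = λ j → trans (B≡ j) (cong (λ v → flip v (y j)) (A≡ j))
      ; D⊆B = λ j → D⊆B (proj₂ (down j))
      ; x∈D = λ j → i∈D (proj₂ (down j))
      -- The edges through `y j` and through `x (nxt j)` share the upper vertex `B (nxt j)`. Their
      -- sets lie in it and have the same truncated sum, so they coincide.
      ; y∈D = λ j → trans (cong (λ v → lookup v (y j))
          (D-unique (nxt j) (nxt j) (nxt j) (proj₂ (down (nxt j))) (proj₂ (up j))
            (⊕-⊆ (Dₓ (nxt j)) (D (proj₂ (up j))) (B (nxt j))
              (D⊆B (proj₂ (down (nxt j)))) (D⊆B (proj₂ (up j))))))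
          (i∈D (proj₂ (up j)))
      ; x≢y = λ j → dir≢ (double j)
      ; y≢x = λ j eq → dir≢ (next10 (double j)) (trans eq (cong dir (sym (double-nxt j))))
      ; x-parity = λ j → left (proj₂ (down j))
      ; y-parity = λ j → left (proj₂ (up j))
      ; unique = λ j k l agree → D-unique j k l (proj₂ (down j)) (proj₂ (down k)) (agree-⊆ j k l agree)
      }
      where
      agree-⊆ : ∀ j k l → (∀ i → lookup (B l) i ≡ false → lookup (Dₓ j) i ≡ lookup (Dₓ k) i) →
        Dₓ j ⊕ Dₓ k ⊆ B l
      agree-⊆ j k l agree i i∈ with lookup (B l) i in eq
      ... | true  = refl
      ... | false = ⊥-elim (true≢false i∈ (trans (lookup-zipWith _xor_ i (Dₓ j) (Dₓ k))
        (trans (cong (_xor lookup (Dₓ k) i) (agree i eq)) (Bool.xor-same (lookup (Dₓ k) i)))))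

  keep-C10-free : ¬ ContainsC10 S
  keep-C10-free (c , c-inj , adj) with parity (c 0F) Bool.≟ not q
  ... | yes top = ¬swapCycle (toSwapCycle c (λ j → next10²≢ j ∘ c-inj) adj top)
  -- If the cycle starts in the lower layer, shifting it by one vertex makes it start in the upper
  -- layer.
  ... | no ¬top = ¬swapCycle (toSwapCycle (c ∘ next10) (λ j → next10²≢ (next10 j) ∘ c-inj) (adj ∘ next10)
    (trans (cong parity (proj₁ (proj₂ (adj 0F)))) (trans (parity-flip (c 0F) (proj₁ (adj 0F)))
      (cong not (trans (Bool.¬-not ¬top) (Bool.not-involutive q))))))

theorem1p1 : (n : ℕ) → 1 ≤ n →
    ∃[ K ] Σ (Subgraph n) λ S →
    ¬ ContainsC10 S × eQ n * numP K < 12 * edgeCount S * denP K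
theorem1p1 n 1≤n with dense-outcome n 1≤n
-- `K` is `n`: the partial products decrease to c, so a strict bound with P_n implies the one with
-- c.
... | (M , w , p , q) , dense = n , keep (M , w , p , q) , keep-C10-free M w p q , dense
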